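{- Let $k$ be a positive integer, $i\in\{3,5,7\}$, and $p$ a prime with $p\equiv i\pmod 8$. Let $\delta$ be a non-negative integer such that $p$ divides $8\delta+i$, and let $m\in\{0,1\}$. Then for every non-negative integer $n$, $\mathcal{J}^*_6(N_1)$ and $\mathcal{J}^*_6(N_2)$ have the same parity, where \[ N_1=3^m p\left(8p^k n+8\delta+i\right),\qquad N_2=3^m\left(8p^{k-1}n+\frac{8\delta+i}{p}\right). \]
   Context: Let $q=e^{2\pi i\tau}$ with $\tau$ in the upper half-plane, and let $\eta(\tau)=q^{1/24}\prod_{n\ge1}(1-q^n)$ be the Dedekind eta function. The Hauptmodul of the Fricke group $\Gamma_0^*(6)$ is \[ j_6^*(\tau)=\left(\frac{\eta(\tau)\eta(3\tau)}{\eta(2\tau)\eta(6\tau)}\right)^6+6+2^6\left(\frac{\eta(2\tau)\eta(6\tau)}{\eta(\tau)\eta(3\tau)}\right)^6=\frac1q+\sum_{n\ge1}\mathcal{J}^*_6(n)q^n, \] and $\mathcal{J}^*_6(n)$ denotes its $n$-th Fourier coefficient (an integer). -}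

module Defs where

open import Data.Bool using (Bool; true; false; if_then_else_)
open import Data.Nat as ℕ using (ℕ; zero; suc; _∸_; _≡ᵇ_; _%_)
open import Data.Integer using (ℤ; +_; -_; _+_; _*_)

-- Formal power series in q with integer coefficients: n ↦ coefficient of q^n.
Ser : Set
Ser = ℕ → ℤ

sumTo : ℕ → (ℕ → ℤ) → ℤ
sumTo zero h = h 0
sumTo (suc n) h = sumTo n h + h (suc n)

one : Ser
one n = if n ≡ᵇ 0 then + 1 else + 0

mul : Ser → Ser → Ser
mul f g n = sumTo n (λ j → f j * g (n ∸ j))

pow : Ser → ℕ → Ser
pow f zero = one
pow f (suc e) = mul f (pow f e)

-- 1 - q^k   (used only for k ≥ 1)
oneMinus : ℕ → Ser
oneMinus k n = if n ≡ᵇ 0 then + 1 else (if n ≡ᵇ k then - (+ 1) else + 0)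

-- 1/(1 - q^k) = Σ_{j≥0} q^{kj}   (used only for k ≥ 1)
geom : ℕ → Ser
geom zero = one
geom (suc j) n = if (n % suc j) ≡ᵇ 0 then + 1 else + 0

prodTo : (ℕ → Ser) → ℕ → Ser
prodTo F zero = one
prodTo F (suc N) = mul (prodTo F N) (F (suc N))

-- P(q) = ∏_{n≥1} ((1-q^n)(1-q^{3n}) / ((1-q^{2n})(1-q^{6n})))^6,
-- so that (η(τ)η(3τ)/(η(2τ)η(6τ)))^6 = q^{-1} P(q).
factorP : ℕ → Ser
factorP n = pow (mul (mul (oneMinus n) (oneMinus (3 ℕ.* n)))
                     (mul (geom (2 ℕ.* n)) (geom (6 ℕ.* n)))) 6

-- Q(q) = 1/P(q) = ∏_{n≥1} ((1-q^{2n})(1-q^{6n}) / ((1-q^n)(1-q^{3n})))^6,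
-- so that (η(2τ)η(6τ)/(η(τ)η(3τ)))^6 = q Q(q).
factorQ : ℕ → Ser
factorQ n = pow (mul (mul (oneMinus (2 ℕ.* n)) (oneMinus (6 ℕ.* n)))
                     (mul (geom n) (geom (3 ℕ.* n)))) 6

-- The coefficient of q^M in the infinite product only involves factors n ≤ M.
coefP : ℕ → ℤ
coefP M = prodTo factorP M M

coefQ : ℕ → ℤ
coefQ M = prodTo factorQ M M

-- 𝒥*_6(n): coefficient of q^n in j_6^* = q^{-1} P + 6 + 64 q Q  (n ≥ 0).
J6* : ℕ → ℤ
J6* zero = coefP 1 + + 6
J6* (suc n) = coefP (suc (suc n)) + + 64 * coefQ n

{-# OPTIONS --safe #-}
-- Modulo 2 one has P = 1/(ψ(q) ψ(q³))² for Gauss's ψ(q) = Σ_j q^(j(j+1)/2) (Shanks's telescoping proof).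
-- The theta identity ψ(q) ψ(q³) = ψ(q)⁴ + q ψ(q³)⁴ mod 2 then gives the repeated 2-dissection
--   P = X⁸ + q⁴ ψ(q³)⁸ + q² ψ(q)⁸ + q⁶ Y⁸,
-- so both 𝒥(8l+1) and 𝒥(3(8l+1)) are odd exactly when l is triangular, that is, when 8l+1 is a square.
-- Multiplication by p² does not affect being a square.
module Submission where

open import Defs
open import Data.Nat using (ℕ; _+_; _*_; _^_; _∸_; _≤_; _%_; _/_; NonZero)
open import Data.Nat.Divisibility using (_∣_)
open import Data.Nat.Primality using (Prime)
open import Data.Integer using (+_; _-_)
open import Data.Integer.Divisibility using () renaming (_∣_ to _∣ℤ_)
open import Data.Sum using (_⊎_)
open import Relation.Binary.PropositionalEquality using (_≡_)

open import Algebra.Bundles using (CommutativeSemiring; RawRing)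
open import Algebra.Solver.Ring.AlmostCommutativeRing using (AlmostCommutativeRing; _-Raw-AlmostCommutative⟶_)
open import Algebra.Structures.Biased using (module IsCommutativeSemiringˡ)
open import Data.Bool using (Bool; true; false; if_then_else_; _xor_; _∧_)
import Data.Bool.Properties as Boolₚ
open import Data.Integer using (ℤ; -_; 0ℤ; 1ℤ)
import Data.Integer as ℤ
import Data.Integer.Divisibility.Signed as Signed
import Data.Integer.Properties as ℤₚ
open import Data.Integer.Tactic.RingSolver using (solve-∀)
open import Data.Maybe using (Maybe; just; nothing)
open import Data.Nat using (zero; suc; _<_; z≤n; s≤s; z<s; _≡ᵇ_)
open import Data.Nat.Divisibility using (divides)
open import Data.Nat.DivMod
  using ([m+n]%n≡m%n; [m+kn]%n≡m%n; m<n⇒m%n≡m; m%n%n≡m%n; m≡m%n+[m/n]*n; m/n*n≡m; %-distribˡ-*)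
open import Data.Nat.Primality using (euclidsLemma)
import Data.Nat.Properties as ℕₚ
open import Data.Nat.Solver using (module +-*-Solver)
open import Data.Product using (∃; _,_)
open import Data.Sum using (inj₁; inj₂)
open import Function using (_∘_; id; flip)
open import Function.Bundles using (_⇔_; mk⇔; Equivalence)
open import Level using (Level; 0ℓ)
open import Relation.Binary.Bundles using (Setoid)
open import Relation.Binary.Definitions using (tri<; tri≈; tri>)
import Relation.Binary.PropositionalEquality as ≡
import Relation.Binary.Reasoning.Setoid as SetoidReasoning
open import Relation.Binary.Structures using (IsEquivalence)
open import Relation.Nullary using (Dec; yes; no; does; contradiction)
open import Relation.Nullary.Decidable using (map′; does-⇔)

-- The exponent 6 yields a square because modulo 2 each quotient (1 - q^n)/(1 - q^(2n)) collapses to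
-- 1/(1 - q^n), while ψ is ∏ (1 - q^n)³: six copies make two theta series in q and two in q³.
-- Everything takes place modulo q^(M+1). There q is nilpotent, infinite products and theta series
-- are finite expressions, and limits are replaced by the vanishing of high powers. The arguments
-- are stated over any commutative semiring with 1 + 1 = 0, so that Shanks's identity serves at q
-- and at q³ alike. In the displayed dissection X = ψ(q)²/ψ(q³) and Y = ψ(q³)²/ψ(q). Reading off a
-- coefficient takes three halvings of the index, ending at l in ψ(q) or at 3l in ψ(q³). For the
-- theorem put d = (8δ+i)/p and a = 8p^(k-1)n + d. Then N₂ = 3^m a and N₁ = 3^m p² a, and p ≡ i
-- modulo 8 with i odd forces d, a and p² a to be 1 modulo 8, the class in which the criterion by
-- squares applies.

-- Triangular numbers and the form T i + 3 T j

T : ℕ → ℕ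
T zero = 0
T (suc n) = T n + suc n

n≤T : ∀ n → n ≤ T n
n≤T zero = z≤n
n≤T (suc n) = ℕₚ.m≤n+m (suc n) (T n)

2*T : ∀ n → 2 * T n ≡ n * suc n
2*T zero = ≡.refl
2*T (suc n) = ≡.trans (ℕₚ.*-distribˡ-+ 2 (T n) (suc n)) (≡.trans (≡.cong (_+ 2 * suc n) (2*T n))
  (solve 1 (λ n → n :* (con 1 :+ n) :+ con 2 :* (con 1 :+ n) := (con 1 :+ n) :* (con 1 :+ (con 1 :+ n))) ≡.refl n))
  where open +-*-Solver

form : ℕ → ℕ → ℕ
form i j = T i + 3 * T j

2*form : ∀ i j → 2 * form i j ≡ i * suc i + 3 * (j * suc j)
2*form i j = ≡.trans (solve 2 (λ s t → con 2 :* (s :+ con 3 :* t) := con 2 :* s :+ con 3 :* (con 2 :* t)) ≡.refl (T i) (T j))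
  (≡.cong₂ (λ s t → s + 3 * t) (2*T i) (2*T j))
  where open +-*-Solver

-- Doubling turns triangular numbers into the polynomials i(i+1), which brings the identities below
-- within reach of the ring solver.
form-≡ : ∀ i j i′ j′ → i * suc i + 3 * (j * suc j) ≡ i′ * suc i′ + 3 * (j′ * suc j′) → form i j ≡ form i′ j′
form-≡ i j i′ j′ eq = ℕₚ.*-cancelˡ-≡ (form i j) (form i′ j′) 2
  (≡.trans (2*form i j) (≡.trans eq (≡.sym (2*form i′ j′))))

-- For x = 2i+1 and y = 2j+1 the reflection (x, y) ↦ ((x+3y)/2, (x-y)/2) preserves x² + 3y². It acts
-- on the pairs with i - j odd and positive; written with i - j = 2c+1, it swaps j and c.
form-symmetric : ∀ j c → form (j + suc (c + c)) j ≡ form (c + suc (j + j)) c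
form-symmetric j c = form-≡ (j + suc (c + c)) j (c + suc (j + j)) c
  (solve 2 (λ j c → side j c := side c j) ≡.refl j c)
  where
  open +-*-Solver
  side : ∀ {n} → Polynomial n → Polynomial n → Polynomial n
  side j c = (j :+ (con 1 :+ (c :+ c))) :* (con 1 :+ (j :+ (con 1 :+ (c :+ c)))) :+ con 3 :* (j :* (con 1 :+ j))

-- Here the symmetry is (x, y) ↦ ((x-3y)/2, (x+y)/2), for i - j even and x > 3y; the image has i <
-- j. `form-odd` treats x < 3y, with the sign of the first coordinate changed.
form-even : ∀ j a → form (j + (suc (j + a) + suc (j + a))) j ≡ form a (suc (a + (j + j)))
form-even j a = form-≡ (j + (suc (j + a) + suc (j + a))) j a (suc (a + (j + j)))
  (solve 2 (λ j a → side (j :+ ((con 1 :+ (j :+ a)) :+ (con 1 :+ (j :+ a)))) j := side a (con 1 :+ (a :+ (j :+ j)))) ≡.refl j a)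
  where
  open +-*-Solver
  side : ∀ {n} → Polynomial n → Polynomial n → Polynomial n
  side i j = i :* (con 1 :+ i) :+ con 3 :* (j :* (con 1 :+ j))

form-odd : ∀ c a → form (suc (c + a) + (suc c + suc c)) (suc (c + a)) ≡ form a (suc (a + suc (c + c)))
form-odd c a = form-≡ (suc (c + a) + (suc c + suc c)) (suc (c + a)) a (suc (a + suc (c + c)))
  (solve 2 (λ c a → side ((con 1 :+ (c :+ a)) :+ ((con 1 :+ c) :+ (con 1 :+ c))) (con 1 :+ (c :+ a))
     := side a (con 1 :+ (a :+ (con 1 :+ (c :+ c))))) ≡.refl c a)
  where
  open +-*-Solver
  side : ∀ {n} → Polynomial n → Polynomial n → Polynomial n
  side i j = i :* (con 1 :+ i) :+ con 3 :* (j :* (con 1 :+ j))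

form-diagonal : ∀ j → form (j + 0) j ≡ T j * 4
form-diagonal j = ≡.trans (≡.cong (λ m → form m j) (ℕₚ.+-identityʳ j)) (ℕₚ.*-comm 4 (T j))

-- These are the fixed points x = 3y of the reflection in `form-symmetric`. They supply the term q
-- ψ(q³)⁴, the successor being the factor q.
form-diagonal₃ : ∀ j → form (j + suc (j + j)) j ≡ suc (3 * T j * 4)
form-diagonal₃ j = ℕₚ.*-cancelˡ-≡ (form (j + suc (j + j)) j) (suc (3 * T j * 4)) 2
  (≡.trans (2*form (j + suc (j + j)) j) (≡.sym (≡.trans
    (solve 1 (λ t → con 2 :* (con 1 :+ con 3 :* t :* con 4) := con 2 :+ con 12 :* (con 2 :* t)) ≡.refl (T j))
    (≡.trans (≡.cong (λ t → 2 + 12 * t) (2*T j))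
      (solve 1 (λ j → con 2 :+ con 12 :* (j :* (con 1 :+ j))
         := (j :+ (con 1 :+ (j :+ j))) :* (con 1 :+ (j :+ (con 1 :+ (j :+ j)))) :+ con 3 :* (j :* (con 1 :+ j))) ≡.refl j)))))
  where open +-*-Solver

-- Finite sums and products in characteristic 2

module Char2 {c ℓ : Level} (R : CommutativeSemiring c ℓ)
  (1+1≈0 : CommutativeSemiring._≈_ R
     (CommutativeSemiring._+_ R (CommutativeSemiring.1# R) (CommutativeSemiring.1# R))
     (CommutativeSemiring.0# R)) where

  open CommutativeSemiring R using (Carrier; _≈_; semiring; setoid; refl; sym; trans; reflexive;
      +-cong; +-congˡ; +-congʳ; *-cong; *-congˡ; *-congʳ; +-identityˡ; +-identityʳ; +-assoc; +-comm;
      *-identityˡ; *-identityʳ; *-assoc; *-comm; zeroˡ; zeroʳ; distribˡ; distribʳ)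
    renaming (_+_ to infixl 6 _⊕_; _*_ to infixl 7 _⊗_; 0# to 𝟘; 1# to 𝟙) public
  open import Algebra.Properties.Semiring.Exp semiring
    using (^-homo-*; ^-assocʳ; ^-congˡ; ^-congʳ) renaming (_^_ to infixr 8 _↑_) public
  open import Algebra.Properties.CommutativeSemiring.Exp R using (^-distrib-*) public
  open import Relation.Binary.Reasoning.Setoid setoid

  -- Coefficients in 𝔽₂, so that the solver decides identities of characteristic 2.
  𝔽₂ : RawRing 0ℓ 0ℓ
  𝔽₂ = record { Carrier = Bool ; _≈_ = _≡_ ; _+_ = _xor_ ; _*_ = _∧_ ; -_ = id ; 0# = false ; 1# = true }

  almostRing : AlmostCommutativeRing c ℓ
  almostRing = record
    { -_ = id
    ; isAlmostCommutativeRing = record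
      { isCommutativeSemiring = CommutativeSemiring.isCommutativeSemiring R
      ; -‿cong = id
      ; -‿*-distribˡ = λ _ _ → refl
      ; -‿+-comm = λ _ _ → refl
      }
    }

  ⟦_⟧₂ : Bool → Carrier
  ⟦ true ⟧₂ = 𝟙
  ⟦ false ⟧₂ = 𝟘

  morphism : 𝔽₂ -Raw-AlmostCommutative⟶ almostRing
  morphism = record
    { ⟦_⟧ = ⟦_⟧₂
    ; +-homo = λ { true true → sym 1+1≈0 ; true false → sym (+-identityʳ 𝟙) ; false y → sym (+-identityˡ ⟦ y ⟧₂) }
    ; *-homo = λ { true y → sym (*-identityˡ ⟦ y ⟧₂) ; false y → sym (zeroˡ ⟦ y ⟧₂) }
    ; -‿homo = λ _ → refl
    ; 0-homo = refl
    ; 1-homo = refl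
    }

  coefficient≟ : ∀ x y → Maybe (⟦ x ⟧₂ ≈ ⟦ y ⟧₂)
  coefficient≟ x y with x Boolₚ.≟ y
  ... | yes ≡.refl = just refl
  ... | no _ = nothing

  open import Algebra.Solver.Ring 𝔽₂ almostRing morphism coefficient≟ public
    using (solve; _:=_; _:+_; _:*_; con; Polynomial)

  ∑ : ℕ → (ℕ → Carrier) → Carrier
  ∑ zero f = 𝟘
  ∑ (suc n) f = f 0 ⊕ ∑ n (f ∘ suc)

  ∏ : (ℕ → Carrier) → ℕ → Carrier
  ∏ F zero = 𝟙
  ∏ F (suc n) = ∏ F n ⊗ F (suc n)

  ∑-cong : ∀ n {f g} → (∀ i → f i ≈ g i) → ∑ n f ≈ ∑ n g
  ∑-cong zero e = refl
  ∑-cong (suc n) e = +-cong (e 0) (∑-cong n (e ∘ suc))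

  ∑-zero : ∀ n {f} → (∀ i → f i ≈ 𝟘) → ∑ n f ≈ 𝟘
  ∑-zero zero e = refl
  ∑-zero (suc n) e = trans (+-cong (e 0) (∑-zero n (e ∘ suc))) (+-identityˡ 𝟘)

  ∑-+ : ∀ n f g → ∑ n (λ i → f i ⊕ g i) ≈ ∑ n f ⊕ ∑ n g
  ∑-+ zero f g = sym (+-identityˡ 𝟘)
  ∑-+ (suc n) f g = trans (+-congˡ (∑-+ n (f ∘ suc) (g ∘ suc)))
    (solve 4 (λ a b c d → (a :+ b) :+ (c :+ d) := (a :+ c) :+ (b :+ d)) refl (f 0) (g 0) _ _)

  ∑-*ˡ : ∀ n x f → x ⊗ ∑ n f ≈ ∑ n (λ i → x ⊗ f i)
  ∑-*ˡ zero x f = zeroʳ x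
  ∑-*ˡ (suc n) x f = trans (distribˡ x _ _) (+-congˡ (∑-*ˡ n x (f ∘ suc)))

  ∑-*ʳ : ∀ n x f → ∑ n f ⊗ x ≈ ∑ n (λ i → f i ⊗ x)
  ∑-*ʳ n x f = trans (*-comm _ x) (trans (∑-*ˡ n x f) (∑-cong n λ i → *-comm x (f i)))

  ∑-last : ∀ n f → ∑ (suc n) f ≈ ∑ n f ⊕ f n
  ∑-last zero f = +-comm (f 0) 𝟘
  ∑-last (suc n) f = trans (+-congˡ (∑-last n (f ∘ suc))) (sym (+-assoc (f 0) _ _))

  ∑-extend : ∀ m n {f} → (∀ i → m ≤ i → f i ≈ 𝟘) → ∑ (m + n) f ≈ ∑ m f
  ∑-extend zero n z = ∑-zero n λ i → z i z≤n
  ∑-extend (suc m) n z = +-congˡ (∑-extend m n λ i m≤i → z (suc i) (s≤s m≤i))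

  ∑-swap : ∀ m n (f : ℕ → ℕ → Carrier) → ∑ m (λ i → ∑ n (f i)) ≈ ∑ n (λ j → ∑ m (λ i → f i j))
  ∑-swap zero n f = sym (∑-zero n λ _ → refl)
  ∑-swap (suc m) n f = trans (+-congˡ (∑-swap m n (f ∘ suc))) (sym (∑-+ n (f 0) _))

  -- Frobenius: the cross terms occur in equal pairs.
  ∑-square : ∀ n f → ∑ n f ⊗ ∑ n f ≈ ∑ n (λ i → f i ⊗ f i)
  ∑-square zero f = zeroˡ 𝟘
  ∑-square (suc n) f = trans
    (solve 2 (λ a b → (a :+ b) :* (a :+ b) := a :* a :+ b :* b) refl (f 0) _)
    (+-congˡ (∑-square n (f ∘ suc)))

  ∑-parity : ∀ n f → ∑ (n + n) f ≈ ∑ n (λ i → f (i + i)) ⊕ ∑ n (λ i → f (suc (i + i)))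
  ∑-parity zero f = sym (+-identityˡ 𝟘)
  ∑-parity (suc n) f = begin
    f 0 ⊕ ∑ (n + suc n) (f ∘ suc)
      ≈⟨ +-congˡ (reflexive (≡.cong (λ k → ∑ k (f ∘ suc)) (ℕₚ.+-suc n n))) ⟩
    f 0 ⊕ (f 1 ⊕ ∑ (n + n) (λ i → f (2 + i)))
      ≈⟨ +-congˡ (+-congˡ (∑-parity n (λ i → f (2 + i)))) ⟩
    f 0 ⊕ (f 1 ⊕ (∑ n (λ i → f (2 + (i + i))) ⊕ ∑ n (λ i → f (3 + (i + i)))))
      ≈⟨ solve 4 (λ a b c d → a :+ (b :+ (c :+ d)) := (a :+ c) :+ (b :+ d)) refl (f 0) (f 1) _ _ ⟩
    f 0 ⊕ ∑ n (λ i → f (2 + (i + i))) ⊕ (f 1 ⊕ ∑ n (λ i → f (3 + (i + i))))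
      ≈⟨ +-cong (+-congˡ (∑-cong n λ i → reflexive (≡.cong f (≡.cong suc (ℕₚ.+-suc i i)))))
                (+-congˡ (∑-cong n λ i → reflexive (≡.cong f (≡.cong (suc ∘ suc) (ℕₚ.+-suc i i))))) ⟨
    _ ∎

  ∏-cong : ∀ n {f g} → (∀ i → f (suc i) ≈ g (suc i)) → ∏ f n ≈ ∏ g n
  ∏-cong zero e = refl
  ∏-cong (suc n) e = *-cong (∏-cong n e) (e n)

  ∏-* : ∀ n f g → ∏ (λ i → f i ⊗ g i) n ≈ ∏ f n ⊗ ∏ g n
  ∏-* zero f g = sym (*-identityˡ 𝟙)
  ∏-* (suc n) f g = trans (*-congʳ (∏-* n f g))
    (solve 4 (λ a b c d → (a :* b) :* (c :* d) := (a :* c) :* (b :* d)) refl _ _ _ _)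

  -- The part of the square [0,n)² below its antidiagonal.
  ∑△ : ℕ → (ℕ → ℕ → Carrier) → Carrier
  ∑△ zero h = 𝟘
  ∑△ (suc n) h = ∑ (suc n) (h 0) ⊕ ∑△ n (h ∘ suc)

  -- The terms past the antidiagonal vanish, so the triangle may be padded to a rectangle. The width
  -- n + d is separate from the height n because dropping the first row shrinks only the height.
  ∑△≈∑∑ : ∀ n d {h : ℕ → ℕ → Carrier} → (∀ i j → n ≤ i + j → h i j ≈ 𝟘) →
          ∑△ n h ≈ ∑ n (λ i → ∑ (n + d) (h i))
  ∑△≈∑∑ zero d z = refl
  ∑△≈∑∑ (suc n) d {h} z = +-cong
    (sym (∑-extend (suc n) d (z 0)))
    (trans (∑△≈∑∑ n (suc d) (λ i j n≤i+j → z (suc i) j (s≤s n≤i+j)))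
           (reflexive (≡.cong (λ m → ∑ n (λ i → ∑ m (h (suc i)))) (ℕₚ.+-suc n d))))

  -- The cut runs along the diagonal: the first triangle holds i ≥ j with a = i - j, the second i <
  -- j with a = j - i - 1. The second reaches column n, one past the square, and the hypothesis
  -- kills that column.
  ∑∑-fold△ : ∀ n {g : ℕ → ℕ → Carrier} → (∀ i → g i n ≈ 𝟘) →
    ∑ n (λ i → ∑ n (g i)) ≈ ∑△ n (λ j a → g (j + a) j) ⊕ ∑△ n (λ i a → g i (suc (i + a)))
  ∑∑-fold△ zero z = sym (+-identityˡ 𝟘)
  ∑∑-fold△ (suc n) {g} z = begin
    g 0 0 ⊕ ∑ n (g 0 ∘ suc) ⊕ ∑ n (λ i → g (suc i) 0 ⊕ ∑ n (g (suc i) ∘ suc))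
      ≈⟨ +-congˡ (trans (∑-+ n _ _) (+-congˡ (∑∑-fold△ n (z ∘ suc)))) ⟩
    g 0 0 ⊕ ∑ n (g 0 ∘ suc) ⊕ (∑ n (λ i → g (suc i) 0) ⊕ (B ⊕ C))
      ≈⟨ solve 5 (λ a b c d e → a :+ b :+ (c :+ (d :+ e)) := (a :+ c) :+ d :+ ((b :+ con false) :+ e))
           refl (g 0 0) (∑ n (g 0 ∘ suc)) (∑ n (λ i → g (suc i) 0)) B C ⟩
    (g 0 0 ⊕ ∑ n (λ i → g (suc i) 0)) ⊕ B ⊕ ((∑ n (g 0 ∘ suc) ⊕ 𝟘) ⊕ C)
      ≈⟨ +-congˡ (+-congʳ (trans (∑-last n (g 0 ∘ suc)) (+-congˡ (z 0)))) ⟨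
    ∑△ (suc n) (λ j a → g (j + a) j) ⊕ ∑△ (suc n) (λ i a → g i (suc (i + a))) ∎
    where
    B = ∑△ n (λ j a → g (suc (j + a)) (suc j))
    C = ∑△ n (λ i a → g (suc i) (suc (suc (i + a))))

  -- With t and t₃ units, the identity t t₃ = t⁴ + q t₃⁴ splits 1/(t t₃) and the two quotients into f² + q g².
  module Dissection {q t t₃ e e₃ : Carrier} (e*t : e ⊗ t ≈ 𝟙) (e₃*t₃ : e₃ ⊗ t₃ ≈ 𝟙)
    (t*t₃ : t ⊗ t₃ ≈ t ↑ 4 ⊕ q ⊗ t₃ ↑ 4) where

    -- Multiplying by a square makes t t₃ appear: e e₃ = (e e₃)² (t t₃). Fourth powers are squares,
    -- so substituting the identity leaves a square plus q times a square. The quotients below start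
    -- from t e₃ = e₃² (t t₃) and t₃ e = e² (t t₃).
    reciprocal : e ⊗ e₃ ≈ (t ⊗ e₃) ⊗ (t ⊗ e₃) ⊕ q ⊗ ((t₃ ⊗ e) ⊗ (t₃ ⊗ e))
    reciprocal = begin
      e ⊗ e₃
        ≈⟨ *-cong (*-identityʳ e) (*-identityʳ e₃) ⟨
      (e ⊗ 𝟙) ⊗ (e₃ ⊗ 𝟙)
        ≈⟨ *-cong (*-congˡ e*t) (*-congˡ e₃*t₃) ⟨
      (e ⊗ (e ⊗ t)) ⊗ (e₃ ⊗ (e₃ ⊗ t₃))
        ≈⟨ solve 4 (λ e t e₃ t₃ → (e :* (e :* t)) :* (e₃ :* (e₃ :* t₃)) := ((e :* e) :* (e₃ :* e₃)) :* (t :* t₃)) refl e t e₃ t₃ ⟩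
      ((e ⊗ e) ⊗ (e₃ ⊗ e₃)) ⊗ (t ⊗ t₃)
        ≈⟨ *-congˡ t*t₃ ⟩
      ((e ⊗ e) ⊗ (e₃ ⊗ e₃)) ⊗ (t ↑ 4 ⊕ q ⊗ t₃ ↑ 4)
        ≈⟨ solve 5 (λ q e t e₃ t₃ →
             ((e :* e) :* (e₃ :* e₃)) :* (t :* (t :* (t :* (t :* con true))) :+ q :* (t₃ :* (t₃ :* (t₃ :* (t₃ :* con true)))))
             := ((e :* t) :* (t :* e₃)) :* ((e :* t) :* (t :* e₃)) :+ q :* (((e₃ :* t₃) :* (t₃ :* e)) :* ((e₃ :* t₃) :* (t₃ :* e))))
             refl q e t e₃ t₃ ⟩
      ((e ⊗ t) ⊗ (t ⊗ e₃)) ⊗ ((e ⊗ t) ⊗ (t ⊗ e₃)) ⊕ q ⊗ (((e₃ ⊗ t₃) ⊗ (t₃ ⊗ e)) ⊗ ((e₃ ⊗ t₃) ⊗ (t₃ ⊗ e)))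
        ≈⟨ +-cong (*-cong (unit e*t) (unit e*t)) (*-congˡ (*-cong (unit e₃*t₃) (unit e₃*t₃))) ⟩
      (t ⊗ e₃) ⊗ (t ⊗ e₃) ⊕ q ⊗ ((t₃ ⊗ e) ⊗ (t₃ ⊗ e)) ∎
      where
      unit : ∀ {u x} → u ≈ 𝟙 → u ⊗ x ≈ x
      unit u≈𝟙 = trans (*-congʳ u≈𝟙) (*-identityˡ _)

    quotient : t ⊗ e₃ ≈ (t ⊗ t ⊗ e₃) ⊗ (t ⊗ t ⊗ e₃) ⊕ q ⊗ (t₃ ⊗ t₃)
    quotient = begin
      t ⊗ e₃
        ≈⟨ *-identityʳ (t ⊗ e₃) ⟨
      t ⊗ e₃ ⊗ 𝟙
        ≈⟨ *-congˡ e₃*t₃ ⟨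
      t ⊗ e₃ ⊗ (e₃ ⊗ t₃)
        ≈⟨ solve 3 (λ t e₃ t₃ → t :* e₃ :* (e₃ :* t₃) := (e₃ :* e₃) :* (t :* t₃)) refl t e₃ t₃ ⟩
      (e₃ ⊗ e₃) ⊗ (t ⊗ t₃)
        ≈⟨ *-congˡ t*t₃ ⟩
      (e₃ ⊗ e₃) ⊗ (t ↑ 4 ⊕ q ⊗ t₃ ↑ 4)
        ≈⟨ solve 4 (λ q t e₃ t₃ →
             (e₃ :* e₃) :* (t :* (t :* (t :* (t :* con true))) :+ q :* (t₃ :* (t₃ :* (t₃ :* (t₃ :* con true)))))
             := (t :* t :* e₃) :* (t :* t :* e₃) :+ q :* (((e₃ :* t₃) :* (e₃ :* t₃)) :* (t₃ :* t₃)))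
             refl q t e₃ t₃ ⟩
      (t ⊗ t ⊗ e₃) ⊗ (t ⊗ t ⊗ e₃) ⊕ q ⊗ (((e₃ ⊗ t₃) ⊗ (e₃ ⊗ t₃)) ⊗ (t₃ ⊗ t₃))
        ≈⟨ +-congˡ (*-congˡ (trans (*-congʳ (trans (*-cong e₃*t₃ e₃*t₃) (*-identityˡ 𝟙))) (*-identityˡ _))) ⟩
      (t ⊗ t ⊗ e₃) ⊗ (t ⊗ t ⊗ e₃) ⊕ q ⊗ (t₃ ⊗ t₃) ∎

    quotient₃ : t₃ ⊗ e ≈ t ⊗ t ⊕ q ⊗ ((t₃ ⊗ t₃ ⊗ e) ⊗ (t₃ ⊗ t₃ ⊗ e))
    quotient₃ = begin
      t₃ ⊗ e
        ≈⟨ *-identityʳ (t₃ ⊗ e) ⟨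
      t₃ ⊗ e ⊗ 𝟙
        ≈⟨ *-congˡ e*t ⟨
      t₃ ⊗ e ⊗ (e ⊗ t)
        ≈⟨ solve 3 (λ t e t₃ → t₃ :* e :* (e :* t) := (e :* e) :* (t :* t₃)) refl t e t₃ ⟩
      (e ⊗ e) ⊗ (t ⊗ t₃)
        ≈⟨ *-congˡ t*t₃ ⟩
      (e ⊗ e) ⊗ (t ↑ 4 ⊕ q ⊗ t₃ ↑ 4)
        ≈⟨ solve 4 (λ q t e t₃ →
             (e :* e) :* (t :* (t :* (t :* (t :* con true))) :+ q :* (t₃ :* (t₃ :* (t₃ :* (t₃ :* con true)))))
             := ((e :* t) :* (e :* t)) :* (t :* t) :+ q :* ((t₃ :* t₃ :* e) :* (t₃ :* t₃ :* e)))
             refl q t e t₃ ⟩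
      ((e ⊗ t) ⊗ (e ⊗ t)) ⊗ (t ⊗ t) ⊕ q ⊗ ((t₃ ⊗ t₃ ⊗ e) ⊗ (t₃ ⊗ t₃ ⊗ e))
        ≈⟨ +-congʳ (trans (*-congʳ (trans (*-cong e*t e*t) (*-identityˡ 𝟙))) (*-identityˡ _)) ⟩
      t ⊗ t ⊕ q ⊗ ((t₃ ⊗ t₃ ⊗ e) ⊗ (t₃ ⊗ t₃ ⊗ e)) ∎

  ∏-↑ : ∀ n f k → ∏ (λ i → f i ↑ k) n ≈ ∏ f n ↑ k
  ∏-↑ zero f k = sym (one-↑ k)
    where
    one-↑ : ∀ k → 𝟙 ↑ k ≈ 𝟙
    one-↑ zero = refl
    one-↑ (suc k) = trans (*-identityˡ _) (one-↑ k)
  ∏-↑ (suc n) f k = trans (*-congʳ (∏-↑ n f k)) (sym (^-distrib-* _ _ k))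

  θ : Carrier → ℕ → Carrier
  θ q n = ∑ n (λ j → q ↑ T j)

  -- Gauss's theta series as a product, for nilpotent q

  module Nilpotent (q : Carrier) (N : ℕ) (q^≈0 : ∀ k → N < k → q ↑ k ≈ 𝟘) where

    -- Shanks's argument: P n = ∏_{k≤n} (1 + q^(2k−1))/(1 + q^(2k)), x n = q^(2n+1), and the sums D t n telescope in t.
    module Gauss (e : ℕ → Carrier) (e-inverse : ∀ k → (𝟙 ⊕ q ↑ suc k) ⊗ e (suc k) ≈ 𝟙) where

      Q : ℕ → Carrier
      Q n = q ↑ n

      x : ℕ → Carrier
      x n = q ⊗ (Q n ⊗ Q n)

      E V O P : ℕ → Carrier
      E = ∏ e
      V = ∏ (λ k → 𝟙 ⊕ Q k)
      O zero = 𝟙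
      O (suc n) = O n ⊗ (𝟙 ⊕ x n)
      P n = O n ⊗ (E n ⊗ E n)

      V*E : ∀ n → V n ⊗ E n ≈ 𝟙
      V*E zero = *-identityˡ 𝟙
      V*E (suc n) = begin
        V n ⊗ (𝟙 ⊕ Q (suc n)) ⊗ (E n ⊗ e (suc n))
          ≈⟨ solve 4 (λ a b c d → a :* b :* (c :* d) := (a :* c) :* (b :* d)) refl (V n) _ (E n) _ ⟩
        (V n ⊗ E n) ⊗ ((𝟙 ⊕ Q (suc n)) ⊗ e (suc n))
          ≈⟨ *-cong (V*E n) (e-inverse n) ⟩
        𝟙 ⊗ 𝟙  ≈⟨ *-identityˡ 𝟙 ⟩
        𝟙 ∎

      x-pow : ∀ n → x n ≈ q ↑ suc (n + n)
      x-pow n = *-congˡ (sym (^-homo-* q n n))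

      -- In characteristic 2, V n ² is the product of the 1 + q^(2k) with k ≤ n, and O n holds the
      -- odd exponents below 2n; interleaved they are all the factors up to 2n.
      O*V²≈V : ∀ n → O n ⊗ (V n ⊗ V n) ≈ V (n + n)
      O*V²≈V zero = solve 0 (con true :* (con true :* con true) := con true) refl
      O*V²≈V (suc n) = begin
        O n ⊗ (𝟙 ⊕ x n) ⊗ (V n ⊗ (𝟙 ⊕ Q (suc n)) ⊗ (V n ⊗ (𝟙 ⊕ Q (suc n))))
          ≈⟨ solve 4 (λ o v a s → o :* a :* (v :* (con true :+ s) :* (v :* (con true :+ s)))
                := o :* (v :* v) :* a :* (con true :+ s :* s)) refl (O n) (V n) (𝟙 ⊕ x n) (Q (suc n)) ⟩
        O n ⊗ (V n ⊗ V n) ⊗ (𝟙 ⊕ x n) ⊗ (𝟙 ⊕ Q (suc n) ⊗ Q (suc n))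
          ≈⟨ *-cong (*-cong (O*V²≈V n) (+-congˡ (x-pow n))) (+-congˡ (sym (^-homo-* q (suc n) (suc n)))) ⟩
        V (n + n) ⊗ (𝟙 ⊕ Q (suc (n + n))) ⊗ (𝟙 ⊕ Q (suc n + suc n))
          ≈⟨ *-congˡ (+-congˡ (reflexive (≡.cong Q (≡.cong suc (ℕₚ.+-suc n n))))) ⟩
        V (suc (suc (n + n)))
          ≈⟨ reflexive (≡.cong V (≡.cong suc (ℕₚ.+-suc n n))) ⟨
        V (suc n + suc n) ∎

      V-stable : ∀ n → V (n + N) ≈ V N
      V-stable zero = refl
      V-stable (suc n) = begin
        V (n + N) ⊗ (𝟙 ⊕ Q (suc n + N))  ≈⟨ *-cong (V-stable n) (+-congˡ (q^≈0 _ (s≤s (ℕₚ.m≤n+m N n)))) ⟩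
        V N ⊗ (𝟙 ⊕ 𝟘)                    ≈⟨ *-congˡ (+-identityʳ 𝟙) ⟩
        V N ⊗ 𝟙                          ≈⟨ *-identityʳ (V N) ⟩
        V N                              ∎

      -- Truncation makes V (2N) equal to V N, so O V² = V at N. Hence O = 1/V = E, which is Euler's
      -- theorem on odd and distinct parts modulo 2, and P = O E² = E³.
      P≈E³ : P N ≈ E N ↑ 3
      P≈E³ = begin
        O N ⊗ (E N ⊗ E N)
          ≈⟨ *-congˡ (*-identityˡ _) ⟨
        O N ⊗ (𝟙 ⊗ (E N ⊗ E N))
          ≈⟨ *-congˡ (*-congʳ (trans (*-cong (V*E N) (V*E N)) (*-identityˡ 𝟙))) ⟨
        O N ⊗ ((V N ⊗ E N) ⊗ (V N ⊗ E N) ⊗ (E N ⊗ E N))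
          ≈⟨ solve 3 (λ o v e → o :* ((v :* e) :* (v :* e) :* (e :* e)) := (o :* (v :* v)) :* (e :* (e :* (e :* e)))) refl (O N) (V N) (E N) ⟩
        (O N ⊗ (V N ⊗ V N)) ⊗ (E N ⊗ (E N ⊗ (E N ⊗ E N)))
          ≈⟨ *-congʳ (trans (O*V²≈V N) (V-stable N)) ⟩
        V N ⊗ (E N ⊗ (E N ⊗ (E N ⊗ E N)))
          ≈⟨ *-assoc _ _ _ ⟨
        V N ⊗ E N ⊗ (E N ⊗ (E N ⊗ E N))
          ≈⟨ trans (*-congʳ (V*E N)) (*-identityˡ _) ⟩
        E N ⊗ (E N ⊗ E N)
          ≈⟨ *-congˡ (*-congˡ (*-identityʳ (E N))) ⟨
        E N ↑ 3 ∎

      a : ℕ → Carrier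
      a n = 𝟙 ⊕ Q n ⊗ Q n

      P-suc : ∀ n → P (suc n) ⊗ a (suc n) ≈ P n ⊗ (𝟙 ⊕ x n)
      P-suc n = begin
        O n ⊗ (𝟙 ⊕ x n) ⊗ (E n ⊗ e (suc n) ⊗ (E n ⊗ e (suc n))) ⊗ (𝟙 ⊕ Q (suc n) ⊗ Q (suc n))
          ≈⟨ solve 5 (λ o b u i s → o :* b :* (u :* i :* (u :* i)) :* (con true :+ s :* s)
               := o :* (u :* u) :* b :* (((con true :+ s) :* i) :* ((con true :+ s) :* i)))
               refl (O n) (𝟙 ⊕ x n) (E n) (e (suc n)) (Q (suc n)) ⟩
        O n ⊗ (E n ⊗ E n) ⊗ (𝟙 ⊕ x n) ⊗ (((𝟙 ⊕ Q (suc n)) ⊗ e (suc n)) ⊗ ((𝟙 ⊕ Q (suc n)) ⊗ e (suc n)))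
          ≈⟨ *-congˡ (trans (*-cong (e-inverse n) (e-inverse n)) (*-identityˡ 𝟙)) ⟩
        O n ⊗ (E n ⊗ E n) ⊗ (𝟙 ⊕ x n) ⊗ 𝟙
          ≈⟨ *-identityʳ _ ⟩
        P n ⊗ (𝟙 ⊕ x n) ∎

      D : ℕ → ℕ → Carrier
      D t n = ∑ t (λ s → P s ⊗ x n ↑ s)

      x-suc : ∀ n s → x (suc n) ↑ s ≈ x n ↑ s ⊗ (Q s ⊗ Q s)
      x-suc n s = begin
        x (suc n) ↑ s
          ≈⟨ ^-congˡ s (solve 2 (λ q r → q :* (q :* r :* (q :* r)) := q :* (r :* r) :* (q :* q)) refl q (Q n)) ⟩
        (x n ⊗ (q ⊗ q)) ↑ s        ≈⟨ ^-distrib-* (x n) (q ⊗ q) s ⟩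
        x n ↑ s ⊗ (q ⊗ q) ↑ s      ≈⟨ *-congˡ (^-distrib-* q q s) ⟩
        x n ↑ s ⊗ (Q s ⊗ Q s)      ∎

      -- Multiply q^(2s)(1 + q^(2n+2)) + (1 + q^(2n+1)) = (1 + q^(2s)) + q^(2n+1)(1 + q^(2s+1)) by
      -- P_s x_n^s. By `P-suc` the right side becomes the sum of the boundary terms P_t a_t x_n^t at
      -- t = s and t = s+1, so summation over s telescopes.
      D-telescope : ∀ n t → a (suc n) ⊗ D t (suc n) ≈ (𝟙 ⊕ x n) ⊗ D t n ⊕ P t ⊗ a t ⊗ x n ↑ t
      -- The boundary term at t = 0 vanishes because a 0 = 1 + 1.
      D-telescope n zero = solve 2 (λ a b →
        a :* con false := b :* con false :+ con true :* (con true :* con true) :* (con true :+ con true :* con true) :* con true)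
        refl (a (suc n)) (𝟙 ⊕ x n)
      D-telescope n (suc t) = begin
        a (suc n) ⊗ D (suc t) (suc n)
          ≈⟨ *-congˡ (∑-last t _) ⟩
        a (suc n) ⊗ (D t (suc n) ⊕ P t ⊗ x (suc n) ↑ t)
          ≈⟨ trans (distribˡ _ _ _) (+-cong (D-telescope n t) (*-congˡ (*-congˡ (x-suc n t)))) ⟩
        (𝟙 ⊕ x n) ⊗ D t n ⊕ P t ⊗ a t ⊗ x n ↑ t ⊕ a (suc n) ⊗ (P t ⊗ (x n ↑ t ⊗ (Q t ⊗ Q t)))
          ≈⟨ solve 6 (λ q n t d p y →
               (con true :+ q :* (n :* n)) :* d :+ p :* (con true :+ t :* t) :* y
                  :+ (con true :+ q :* n :* (q :* n)) :* (p :* (y :* (t :* t)))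
               := (con true :+ q :* (n :* n)) :* (d :+ p :* y) :+ p :* (con true :+ q :* (t :* t)) :* ((q :* (n :* n)) :* y))
               refl q (Q n) (Q t) (D t n) (P t) (x n ↑ t) ⟩
        (𝟙 ⊕ x n) ⊗ (D t n ⊕ P t ⊗ x n ↑ t) ⊕ P t ⊗ (𝟙 ⊕ x t) ⊗ x n ↑ suc t
          ≈⟨ +-cong (*-congˡ (∑-last t _)) (*-congʳ (P-suc t)) ⟨
        (𝟙 ⊕ x n) ⊗ D (suc t) n ⊕ P (suc t) ⊗ a (suc t) ⊗ x n ↑ suc t ∎

      -- T (2n) = n(2n+1) and T (2n+1) = (n+1)(2n+1), so the two terms by which the theta sum grows
      -- in `θ-suc` are powers of the same x n.
      x-T : ∀ n → x n ↑ n ≈ q ↑ T (n + n)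
      x-T n = begin
        x n ↑ n                    ≈⟨ ^-congˡ n (x-pow n) ⟩
        (q ↑ suc (n + n)) ↑ n      ≈⟨ ^-assocʳ q (suc (n + n)) n ⟩
        q ↑ (suc (n + n) * n)      ≈⟨ ^-congʳ q (ℕₚ.*-cancelˡ-≡ (suc (n + n) * n) (T (n + n)) 2 (≡.trans (ident n) (≡.sym (2*T (n + n))))) ⟩
        q ↑ T (n + n)              ∎
        where
        ident : ∀ n → 2 * (suc (n + n) * n) ≡ (n + n) * suc (n + n)
        ident = S.solve 1 (λ n → S.con 2 S.:* ((S.con 1 S.:+ (n S.:+ n)) S.:* n) S.:= (n S.:+ n) S.:* (S.con 1 S.:+ (n S.:+ n))) ≡.refl
          where module S = +-*-Solver

      x-T′ : ∀ n → x n ↑ suc n ≈ q ↑ T (suc (n + n))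
      x-T′ n = begin
        x n ⊗ x n ↑ n                      ≈⟨ *-comm (x n) _ ⟩
        x n ↑ n ⊗ x n                      ≈⟨ *-cong (x-T n) (x-pow n) ⟩
        q ↑ T (n + n) ⊗ q ↑ suc (n + n)    ≈⟨ ^-homo-* q (T (n + n)) (suc (n + n)) ⟨
        q ↑ T (suc (n + n))                ∎

      θ-suc : ∀ n → θ q (suc n + suc n) ≈ θ q (n + n) ⊕ x n ↑ n ⊕ x n ↑ suc n
      θ-suc n = begin
        θ q (suc n + suc n)                                      ≈⟨ reflexive (≡.cong (θ q ∘ suc) (ℕₚ.+-suc n n)) ⟩
        θ q (suc (suc (n + n)))                                  ≈⟨ ∑-last (suc (n + n)) (λ j → q ↑ T j) ⟩
        θ q (suc (n + n)) ⊕ q ↑ T (suc (n + n))                  ≈⟨ +-congʳ (∑-last (n + n) (λ j → q ↑ T j)) ⟩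
        θ q (n + n) ⊕ q ↑ T (n + n) ⊕ q ↑ T (suc (n + n))        ≈⟨ +-cong (+-congˡ (x-T n)) (x-T′ n) ⟨
        θ q (n + n) ⊕ x n ↑ n ⊕ x n ↑ suc n ∎

      a-cancel : ∀ n {u v} → a (suc n) ⊗ u ≈ a (suc n) ⊗ v → u ≈ v
      a-cancel n {u} {v} eq = trans (sym (cancel u)) (trans (*-congˡ eq) (cancel v))
        where
        i = e (suc n)
        cancel : ∀ u → (i ⊗ i) ⊗ (a (suc n) ⊗ u) ≈ u
        cancel u = begin
          (i ⊗ i) ⊗ (a (suc n) ⊗ u)
            ≈⟨ solve 3 (λ i s u → (i :* i) :* ((con true :+ s :* s) :* u) := ((con true :+ s) :* i) :* ((con true :+ s) :* i) :* u)
                 refl i (Q (suc n)) u ⟩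
          ((𝟙 ⊕ Q (suc n)) ⊗ i) ⊗ ((𝟙 ⊕ Q (suc n)) ⊗ i) ⊗ u
            ≈⟨ *-congʳ (trans (*-cong (e-inverse n) (e-inverse n)) (*-identityˡ 𝟙)) ⟩
          𝟙 ⊗ u ≈⟨ *-identityˡ u ⟩
          u ∎

      -- Shanks's finite identity. Telescoping relates D (n+1) (n+1) to D (n+1) n; by `P-suc` the
      -- boundary term shares the factor P n (1 + x n), which leaves θ together with exactly its
      -- next two terms.
      D≈P*θ : ∀ n → D n n ≈ P n ⊗ θ q (n + n)
      D≈P*θ zero = sym (zeroʳ _)
      D≈P*θ (suc n) = a-cancel n (begin
        a (suc n) ⊗ D (suc n) (suc n)
          ≈⟨ D-telescope n (suc n) ⟩
        (𝟙 ⊕ x n) ⊗ D (suc n) n ⊕ P (suc n) ⊗ a (suc n) ⊗ x n ↑ suc n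
          ≈⟨ +-cong (*-congˡ (trans (∑-last n _) (+-congʳ (D≈P*θ n)))) (*-congʳ (P-suc n)) ⟩
        (𝟙 ⊕ x n) ⊗ (P n ⊗ θ q (n + n) ⊕ P n ⊗ x n ↑ n) ⊕ P n ⊗ (𝟙 ⊕ x n) ⊗ x n ↑ suc n
          ≈⟨ solve 5 (λ b p t y z → b :* (p :* t :+ p :* y) :+ p :* b :* z := p :* b :* (t :+ y :+ z))
               refl (𝟙 ⊕ x n) (P n) (θ q (n + n)) (x n ↑ n) (x n ↑ suc n) ⟩
        P n ⊗ (𝟙 ⊕ x n) ⊗ (θ q (n + n) ⊕ x n ↑ n ⊕ x n ↑ suc n)
          ≈⟨ *-cong (P-suc n) (θ-suc n) ⟨
        P (suc n) ⊗ a (suc n) ⊗ θ q (suc n + suc n)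
          ≈⟨ solve 3 (λ p a t → p :* a :* t := a :* (p :* t)) refl _ _ _ ⟩
        a (suc n) ⊗ (P (suc n) ⊗ θ q (suc n + suc n)) ∎)

      x-vanishes : x N ≈ 𝟘
      x-vanishes = trans (x-pow N) (q^≈0 _ (s≤s (ℕₚ.m≤m+n N N)))

      -- Since x N = q^(2N+1) = 0, only the term s = 0 of D N N survives; N > 0 ensures that it is
      -- present.
      E³*θ≈1 : 0 < N → E N ↑ 3 ⊗ θ q (N + N) ≈ 𝟙
      E³*θ≈1 N>0 = begin
        E N ↑ 3 ⊗ θ q (N + N) ≈⟨ *-congʳ P≈E³ ⟨
        P N ⊗ θ q (N + N)     ≈⟨ D≈P*θ N ⟨
        D N N                 ≈⟨ D-positive N>0 ⟩
        𝟙                     ∎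
        where
        D-positive : ∀ {n} → 0 < n → D n N ≈ 𝟙
        D-positive {suc n} _ = begin
          D (suc n) N ≈⟨ +-cong (solve 0 (con true :* (con true :* con true) :* con true := con true) refl)
                    (∑-zero n λ s → trans (*-congˡ (trans (*-congʳ x-vanishes) (zeroˡ _))) (zeroʳ _)) ⟩
          𝟙 ⊕ 𝟘 ≈⟨ +-identityʳ 𝟙 ⟩
          𝟙 ∎

    -- The theta identity modulo 2

    module Level3 (K : ℕ) (N<K : N < K) where

      W : (ℕ → ℕ → ℕ) → Carrier
      W e = ∑ K (λ i → ∑ K (λ j → q ↑ e i j))

      -- Under this bound every term with i + j ≥ K vanishes, so `W` may be folded, split and padded
      -- without boundary corrections. The reindexings below preserve it.
      Dominates : (ℕ → ℕ → ℕ) → Set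
      Dominates e = ∀ i j → i + j ≤ e i j

      q^≈0′ : ∀ {m n} → K ≤ m → m ≤ n → q ↑ n ≈ 𝟘
      q^≈0′ K≤m m≤n = q^≈0 _ (ℕₚ.<-≤-trans N<K (ℕₚ.≤-trans K≤m m≤n))

      dominates-right : ∀ {e} (φ : ℕ → ℕ) → Dominates e → (∀ j → j ≤ φ j) → Dominates (λ i j → e i (φ j))
      dominates-right φ dom ≤φ i j = ℕₚ.≤-trans (ℕₚ.+-monoʳ-≤ i (≤φ j)) (dom i (φ j))

      dominates-flip : ∀ {e} → Dominates e → Dominates (flip e)
      dominates-flip dom i j = ℕₚ.≤-trans (ℕₚ.≤-reflexive (ℕₚ.+-comm i j)) (dom j i)

      dominates-below : ∀ {e} → Dominates e → Dominates (λ j a → e (j + a) j)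
      dominates-below dom j a = ℕₚ.≤-trans (ℕₚ.m≤m+n (j + a) j) (dom (j + a) j)

      dominates-above : ∀ {e} → Dominates e → Dominates (λ i a → e i (suc (i + a)))
      dominates-above dom i a = ℕₚ.≤-trans (ℕₚ.≤-trans (ℕₚ.n≤1+n (i + a)) (ℕₚ.m≤n+m (suc (i + a)) i)) (dom i _)

      W-cong : ∀ {e f} → (∀ i j → e i j ≡ f i j) → W e ≈ W f
      W-cong eq = ∑-cong K λ i → ∑-cong K λ j → ^-congʳ q (eq i j)

      W-flip : ∀ e → W e ≈ W (flip e)
      W-flip e = ∑-swap K K (λ i j → q ↑ e i j)

      W-fold : ∀ {e} → Dominates e → W e ≈ W (λ j a → e (j + a) j) ⊕ W (λ i a → e i (suc (i + a)))
      W-fold {e} dom = trans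
        (∑∑-fold△ K {λ i j → q ↑ e i j} (λ i → q^≈0′ (ℕₚ.m≤n+m K i) (dom i K)))
        (+-cong (△ (dominates-below dom)) (△ (dominates-above dom)))
        where
        △ : ∀ {f} → Dominates f → ∑△ K (λ i j → q ↑ f i j) ≈ W f
        △ {f} dom′ = trans
          (∑△≈∑∑ K 0 (λ i j K≤ → q^≈0′ K≤ (dom′ i j)))
          (reflexive (≡.cong (λ m → ∑ K (λ i → ∑ m (λ j → q ↑ f i j))) (ℕₚ.+-identityʳ K)))

      W-parity : ∀ {e} → Dominates e → W e ≈ W (λ i c → e i (c + c)) ⊕ W (λ i c → e i (suc (c + c)))
      W-parity {e} dom = trans
        (∑-cong K λ i → trans
          (sym (∑-extend K K (λ j K≤j → q^≈0′ (ℕₚ.≤-trans K≤j (ℕₚ.m≤n+m j i)) (dom i j))))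
          (∑-parity K (λ j → q ↑ e i j)))
        (∑-+ K _ _)

      W-peel : ∀ {e} → Dominates e → W e ≈ ∑ K (λ i → q ↑ e i 0) ⊕ W (λ i j → e i (suc j))
      W-peel {e} dom = trans (∑-cong K peel) (∑-+ K _ _)
        where
        peel : ∀ i → ∑ K (λ j → q ↑ e i j) ≈ q ↑ e i 0 ⊕ ∑ K (λ j → q ↑ e i (suc j))
        peel i = begin
          ∑ K (λ j → q ↑ e i j)               ≈⟨ +-identityʳ _ ⟨
          ∑ K (λ j → q ↑ e i j) ⊕ 𝟘           ≈⟨ +-congˡ (q^≈0′ (ℕₚ.m≤n+m K i) (dom i K)) ⟨
          ∑ K (λ j → q ↑ e i j) ⊕ q ↑ e i K   ≈⟨ ∑-last K (λ j → q ↑ e i j) ⟨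
          ∑ (suc K) (λ j → q ↑ e i j)         ∎

      -- Entries off the diagonal cancel in pairs: once the diagonal is peeled off, symmetry makes
      -- the two halves of the fold equal.
      W-symmetric : ∀ {e} → Dominates e → (∀ i j → e i j ≡ e j i) → W e ≈ ∑ K (λ i → q ↑ e i i)
      W-symmetric {e} dom e-sym = begin
        W e
          ≈⟨ W-fold dom ⟩
        W (λ j a → e (j + a) j) ⊕ W above
          ≈⟨ +-congʳ (W-peel (dominates-below dom)) ⟩
        ∑ K (λ j → q ↑ e (j + 0) j) ⊕ W (λ j a → e (j + suc a) j) ⊕ W above
          ≈⟨ +-congʳ (+-cong (∑-cong K λ j → ^-congʳ q (≡.cong (λ m → e m j) (ℕₚ.+-identityʳ j)))
                             (W-cong λ j a → ≡.trans (e-sym (j + suc a) j) (≡.cong (e j) (ℕₚ.+-suc j a)))) ⟩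
        ∑ K (λ i → q ↑ e i i) ⊕ W above ⊕ W above
          ≈⟨ solve 2 (λ a b → a :+ b :+ b := a) refl _ (W above) ⟩
        ∑ K (λ i → q ↑ e i i) ∎
        where
        above : ℕ → ℕ → ℕ
        above i a = e i (suc (i + a))

      m≤m+m : ∀ m → m ≤ m + m
      m≤m+m m = ℕₚ.m≤m+n m m

      form-dominates : Dominates form
      form-dominates i j = ℕₚ.+-mono-≤ (n≤T i) (ℕₚ.≤-trans (n≤T j) (ℕₚ.m≤m+n (T j) _))

      -- Up to the factor 8 and the shift 4, form i j is x² + 3y² with x = 2i + 1 and y = 2j + 1,
      -- and the cancelling terms are those exchanged by a unit of ℤ[ω].
      W-form : W form ≈ ∑ K (λ j → q ↑ (T j * 4)) ⊕ q ⊗ ∑ K (λ j → q ↑ (3 * T j * 4))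
      W-form = begin
        W form
          ≈⟨ W-fold form-dominates ⟩
        W below ⊕ W above
          ≈⟨ +-cong (W-parity below-dominates) (W-parity (dominates-above form-dominates)) ⟩
        W below-even ⊕ W below-odd ⊕ (W above-even ⊕ W above-odd)
          -- Below the diagonal the split is by the parity of i - j. In the even part i = j is
          -- separated; in the odd part only the fixed points of `form-symmetric` survive.
          ≈⟨ +-congʳ (+-cong (W-peel (dominates-right (λ c → c + c) below-dominates m≤m+m))
                             (W-symmetric (dominates-right (λ c → suc (c + c)) below-dominates (λ c → ℕₚ.m≤n⇒m≤1+n (m≤m+m c))) form-symmetric)) ⟩
        ∑ K (λ j → q ↑ below-even j 0) ⊕ W below-even⁺ ⊕ ∑ K (λ j → q ↑ below-odd j j) ⊕ (W above-even ⊕ W above-odd)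
          ≈⟨ +-congʳ (+-cong (+-cong (∑-cong K λ j → ^-congʳ q (form-diagonal j)) below-even⁺≈) (∑-cong K λ j → ^-congʳ q (form-diagonal₃ j))) ⟩
        ∑ K (λ j → q ↑ (T j * 4)) ⊕ (W above-even ⊕ W above-odd) ⊕ ∑ K (λ j → q ⊗ q ↑ (3 * T j * 4)) ⊕ (W above-even ⊕ W above-odd)
          ≈⟨ solve 3 (λ a b c → a :+ b :+ c :+ b := a :+ c) refl _ (W above-even ⊕ W above-odd) _ ⟩
        ∑ K (λ j → q ↑ (T j * 4)) ⊕ ∑ K (λ j → q ⊗ q ↑ (3 * T j * 4))
          ≈⟨ +-congˡ (∑-*ˡ K q (λ j → q ↑ (3 * T j * 4))) ⟨
        ∑ K (λ j → q ↑ (T j * 4)) ⊕ q ⊗ ∑ K (λ j → q ↑ (3 * T j * 4)) ∎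
        where
        below above below-even below-odd below-even⁺ above-even above-odd : ℕ → ℕ → ℕ
        below j a = form (j + a) j
        above i a = form i (suc (i + a))
        below-even j c = below j (c + c)
        below-odd j c = below j (suc (c + c))
        below-even⁺ j c = below-even j (suc c)
        above-even i c = above i (c + c)
        above-odd i c = above i (suc (c + c))
        below-dominates : Dominates below
        below-dominates = dominates-below form-dominates
        -- Here i - j = 2(c+1). Folding along c = j separates x > 3y from x < 3y, as `form-even` and
        -- `form-odd` require; x = 3y cannot occur for this parity. The images are all the terms
        -- with i < j, so the two sets cancel in `W-form`.
        below-even⁺≈ : W below-even⁺ ≈ W above-even ⊕ W above-odd
        below-even⁺≈ = begin
          W below-even⁺
            ≈⟨ W-flip below-even⁺ ⟩
          W (flip below-even⁺)
            ≈⟨ W-fold (dominates-flip (dominates-right (λ c → suc c + suc c) below-dominates (λ c → ℕₚ.≤-trans (ℕₚ.n≤1+n c) (m≤m+m (suc c))))) ⟩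
          W (λ j a → below-even⁺ j (j + a)) ⊕ W (λ c a → below-even⁺ (suc (c + a)) c)
            ≈⟨ +-cong (W-cong form-even) (W-cong form-odd) ⟩
          W (flip above-even) ⊕ W (flip above-odd)
            ≈⟨ +-cong (W-flip above-even) (W-flip above-odd) ⟨
          W above-even ⊕ W above-odd ∎

      θ-fourth : ∀ m → θ (q ↑ m) K ↑ 4 ≈ ∑ K (λ j → q ↑ (m * T j * 4))
      θ-fourth m = begin
        θ (q ↑ m) K ↑ 4
          ≈⟨ fourth (θ (q ↑ m) K) ⟩
        (θ (q ↑ m) K ⊗ θ (q ↑ m) K) ⊗ (θ (q ↑ m) K ⊗ θ (q ↑ m) K)
          ≈⟨ trans (*-cong (∑-square K _) (∑-square K _)) (∑-square K _) ⟩
        ∑ K (λ j → (t j ⊗ t j) ⊗ (t j ⊗ t j))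
          ≈⟨ ∑-cong K (λ j → trans (sym (fourth (t j))) (trans (^-congˡ 4 (^-assocʳ q m (T j))) (^-assocʳ q (m * T j) 4))) ⟩
        ∑ K (λ j → q ↑ (m * T j * 4)) ∎
        where
        t : ℕ → Carrier
        t j = (q ↑ m) ↑ T j
        fourth : ∀ x → x ↑ 4 ≈ (x ⊗ x) ⊗ (x ⊗ x)
        fourth x = solve 1 (λ x → x :* (x :* (x :* (x :* con true))) := (x :* x) :* (x :* x)) refl x

      θ*θ₃ : θ q K ⊗ θ (q ↑ 3) K ≈ θ q K ↑ 4 ⊕ q ⊗ θ (q ↑ 3) K ↑ 4
      θ*θ₃ = begin
        θ q K ⊗ θ (q ↑ 3) K
          ≈⟨ ∑-*ʳ K (θ (q ↑ 3) K) (λ i → q ↑ T i) ⟩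
        ∑ K (λ i → q ↑ T i ⊗ θ (q ↑ 3) K)
          ≈⟨ ∑-cong K (λ i → trans (∑-*ˡ K (q ↑ T i) _)
               (∑-cong K λ j → trans (*-congˡ (^-assocʳ q 3 (T j))) (sym (^-homo-* q (T i) (3 * T j))))) ⟩
        W form
          ≈⟨ W-form ⟩
        ∑ K (λ j → q ↑ (T j * 4)) ⊕ q ⊗ ∑ K (λ j → q ↑ (3 * T j * 4))
          -- Rewriting q as `q ↑ 1` lets `θ-fourth` serve both theta series.
          ≈⟨ +-cong (trans (^-congˡ 4 (∑-cong K λ j → ^-congˡ (T j) (sym (*-identityʳ q))))
                     (trans (θ-fourth 1) (∑-cong K λ j → ^-congʳ q (≡.cong (_* 4) (ℕₚ.*-identityˡ (T j))))))
                    (*-congˡ (θ-fourth 3)) ⟨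
        θ q K ↑ 4 ⊕ q ⊗ θ (q ↑ 3) K ↑ 4 ∎

  -- The eta quotient as an inverse square of theta series

  module EtaQuotient (q : Carrier) (N : ℕ) (N>0 : 0 < N) (q^≈0 : ∀ k → N < k → q ↑ k ≈ 𝟘)
    (u g : ℕ → Carrier) (u≈ : ∀ k → u (suc k) ≈ 𝟙 ⊕ q ↑ suc k) (g-inverse : ∀ k → (𝟙 ⊕ q ↑ suc k) ⊗ g (suc k) ≈ 𝟙) where

    g₃ : ℕ → Carrier
    g₃ n = g (3 * n)

    q³^≈0 : ∀ k → N < k → (q ↑ 3) ↑ k ≈ 𝟘
    q³^≈0 k N<k = trans (^-assocʳ q 3 k) (q^≈0 (3 * k) (ℕₚ.<-≤-trans N<k (ℕₚ.m≤n*m k 3)))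

    g₃-inverse : ∀ k → (𝟙 ⊕ (q ↑ 3) ↑ suc k) ⊗ g₃ (suc k) ≈ 𝟙
    g₃-inverse k = trans (*-congʳ (+-congˡ (^-assocʳ q 3 (suc k)))) (g-inverse (k + 2 * suc k))

    module G = Nilpotent.Gauss q N q^≈0 g g-inverse
    module G₃ = Nilpotent.Gauss (q ↑ 3) N q³^≈0 g₃ g₃-inverse

    -- Shanks's identity at N yields theta sums of 2N terms, which fixes this length.
    K : ℕ
    K = N + N

    N<K : N < K
    N<K = ℕₚ.m<m+n N N>0

    t t₃ e e₃ : Carrier
    t = θ q K
    t₃ = θ (q ↑ 3) K
    e = G.E N ↑ 3
    e₃ = G₃.E N ↑ 3

    open Dissection {q} {t} {t₃} {e} {e₃} (G.E³*θ≈1 N>0) (G₃.E³*θ≈1 N>0) (Nilpotent.Level3.θ*θ₃ q N q^≈0 K N<K) public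

    -- Insert (1 + y) g = 1 and use (1 + y)² = 1 + y² = 1 + q^(2k+2).
    g-double : ∀ k → u (suc k) ⊗ g (2 * suc k) ≈ g (suc k)
    g-double k = begin
      u (suc k) ⊗ g (2 * suc k)
        ≈⟨ *-congʳ (u≈ k) ⟩
      (𝟙 ⊕ y) ⊗ g (2 * suc k)
        ≈⟨ trans (*-congʳ (g-inverse k)) (*-identityˡ _) ⟨
      (𝟙 ⊕ y) ⊗ g (suc k) ⊗ ((𝟙 ⊕ y) ⊗ g (2 * suc k))
        ≈⟨ solve 3 (λ y a b → (con true :+ y) :* a :* ((con true :+ y) :* b) := a :* ((con true :+ y :* y) :* b))
             refl y (g (suc k)) (g (2 * suc k)) ⟩
      g (suc k) ⊗ ((𝟙 ⊕ y ⊗ y) ⊗ g (2 * suc k))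
        ≈⟨ *-congˡ (*-congʳ (+-congˡ (trans
             (^-congʳ q (≡.cong (λ j → suc k + j) (ℕₚ.+-identityʳ (suc k)))) (^-homo-* q (suc k) (suc k))))) ⟨
      g (suc k) ⊗ ((𝟙 ⊕ q ↑ (2 * suc k)) ⊗ g (2 * suc k))
        ≈⟨ *-congˡ (g-inverse (k + 1 * suc k)) ⟩
      g (suc k) ⊗ 𝟙
        ≈⟨ *-identityʳ _ ⟩
      g (suc k) ∎
      where y = q ↑ suc k

    factor : ℕ → Carrier
    factor n = (u n ⊗ u (3 * n) ⊗ (g (2 * n) ⊗ g (6 * n))) ↑ 6

    factor≈ : ∀ k → factor (suc k) ≈ (g (suc k) ⊗ g₃ (suc k)) ↑ 6
    factor≈ k = ^-congˡ 6 (begin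
      u n ⊗ u (3 * n) ⊗ (g (2 * n) ⊗ g (6 * n))
        ≈⟨ *-congˡ (*-congˡ (reflexive (≡.cong g (ℕₚ.*-assoc 2 3 n)))) ⟩
      u n ⊗ u (3 * n) ⊗ (g (2 * n) ⊗ g (2 * (3 * n)))
        ≈⟨ solve 4 (λ a b c d → a :* b :* (c :* d) := (a :* c) :* (b :* d)) refl _ _ _ _ ⟩
      (u n ⊗ g (2 * n)) ⊗ (u (3 * n) ⊗ g (2 * (3 * n)))
        ≈⟨ *-cong (g-double k) (g-double (k + 2 * suc k)) ⟩
      g n ⊗ g₃ n ∎)
      where n = suc k

    -- Since 6 = 2 · 3 and the cubes `e`, `e₃` are the inverse theta series, a square remains.
    ∏-factor≈ : ∏ factor N ≈ (e ⊗ e₃) ⊗ (e ⊗ e₃)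
    ∏-factor≈ = begin
      ∏ factor N                        ≈⟨ ∏-cong N factor≈ ⟩
      ∏ (λ n → (g n ⊗ g₃ n) ↑ 6) N      ≈⟨ ∏-↑ N (λ n → g n ⊗ g₃ n) 6 ⟩
      ∏ (λ n → g n ⊗ g₃ n) N ↑ 6        ≈⟨ ^-congˡ 6 (∏-* N g g₃) ⟩
      (G.E N ⊗ G₃.E N) ↑ 6
        ≈⟨ solve 2 (λ a b → cube (a :* b) (cube (a :* b) (con true))
              := (cube a (con true) :* cube b (con true)) :* (cube a (con true) :* cube b (con true)))
              refl (G.E N) (G₃.E N) ⟩
      (e ⊗ e₃) ⊗ (e ⊗ e₃) ∎
      where
      cube : ∀ {n} → Polynomial n → Polynomial n → Polynomial n
      cube x y = x :* (x :* (x :* y))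

    ∏-factor≈square : let f = (t ⊗ e₃) ⊗ (t ⊗ e₃) ⊕ q ⊗ ((t₃ ⊗ e) ⊗ (t₃ ⊗ e)) in ∏ factor N ≈ f ⊗ f
    ∏-factor≈square = trans ∏-factor≈ (*-cong reciprocal reciprocal)

open ≡ using (_≢_; refl; sym; trans; cong; cong₂; subst; subst₂; module ≡-Reasoning)

-- Congruence of integers modulo 2

infix 4 _~_

-- A record rather than the bare divisibility, from which x and y could not be inferred.
record _~_ (x y : ℤ) : Set where
  constructor mod2
  field even-difference : (+ 2) Signed.∣ (x - y)

~-reflexive : ∀ {x y} → x ≡ y → x ~ y
~-reflexive {x} refl = mod2 (Signed.divides 0ℤ (ℤₚ.+-inverseʳ x))

~-refl : ∀ {x} → x ~ x
~-refl = ~-reflexive refl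

~-sym : ∀ {x y} → x ~ y → y ~ x
~-sym {x} {y} (mod2 d) = mod2 (subst ((+ 2) Signed.∣_) (flip-sub x y) (Signed.∣m⇒∣-m d))
  where
  flip-sub : ∀ x y → - (x - y) ≡ y - x
  flip-sub = solve-∀

~-trans : ∀ {x y z} → x ~ y → y ~ z → x ~ z
~-trans {x} {y} {z} (mod2 d) (mod2 e) =
  mod2 (subst ((+ 2) Signed.∣_) (telescope x y z) (Signed.∣m∣n⇒∣m+n d e))
  where
  telescope : ∀ x y z → (x - y) ℤ.+ (y - z) ≡ x - z
  telescope = solve-∀

+-cong-~ : ∀ {x y u v} → x ~ y → u ~ v → x ℤ.+ u ~ y ℤ.+ v
+-cong-~ {x} {y} {u} {v} (mod2 d) (mod2 e) =
  mod2 (subst ((+ 2) Signed.∣_) (shuffle x y u v) (Signed.∣m∣n⇒∣m+n d e))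
  where
  shuffle : ∀ x y u v → (x - y) ℤ.+ (u - v) ≡ (x ℤ.+ u) - (y ℤ.+ v)
  shuffle = solve-∀

*-cong-~ : ∀ {x y u v} → x ~ y → u ~ v → x ℤ.* u ~ y ℤ.* v
*-cong-~ {x} {y} {u} {v} (mod2 d) (mod2 e) =
  mod2 (subst ((+ 2) Signed.∣_) (shuffle x y u v)
    (Signed.∣m∣n⇒∣m+n (Signed.∣m⇒∣m*n u d) (Signed.∣n⇒∣m*n y e)))
  where
  shuffle : ∀ x y u v → (x - y) ℤ.* u ℤ.+ y ℤ.* (u - v) ≡ x ℤ.* u - y ℤ.* v
  shuffle = solve-∀

~-setoid : Setoid 0ℓ 0ℓ
~-setoid = record
  { _≈_ = _~_
  ; isEquivalence = record { refl = ~-refl ; sym = ~-sym ; trans = ~-trans }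
  }

x+x~0 : ∀ x → x ℤ.+ x ~ 0ℤ
x+x~0 x = mod2 (Signed.divides x (double x))
  where
  double : ∀ x → x ℤ.+ x - 0ℤ ≡ x ℤ.* (+ 2)
  double = solve-∀

-x~x : ∀ x → - x ~ x
-x~x x = mod2 (Signed.divides (- x) (double x))
  where
  double : ∀ x → - x - x ≡ - x ℤ.* (+ 2)
  double = solve-∀

n*n~n : ∀ n → (+ n) ℤ.* (+ n) ~ + n
n*n~n zero = ~-refl
n*n~n (suc n) = begin
  (+ suc n) ℤ.* (+ suc n)                      ≡⟨ expand (+ n) ⟩
  (+ n) ℤ.* (+ n) ℤ.+ 1ℤ ℤ.+ ((+ n) ℤ.+ (+ n)) ≈⟨ +-cong-~ (+-cong-~ (n*n~n n) ~-refl) (x+x~0 (+ n)) ⟩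
  (+ n) ℤ.+ 1ℤ ℤ.+ 0ℤ                          ≡⟨ collapse (+ n) ⟩
  + suc n                                      ∎
  where
  open SetoidReasoning ~-setoid
  expand : ∀ x → (1ℤ ℤ.+ x) ℤ.* (1ℤ ℤ.+ x) ≡ x ℤ.* x ℤ.+ 1ℤ ℤ.+ (x ℤ.+ x)
  expand = solve-∀
  collapse : ∀ x → x ℤ.+ 1ℤ ℤ.+ 0ℤ ≡ 1ℤ ℤ.+ x
  collapse = solve-∀

x*x~x : ∀ x → x ℤ.* x ~ x
x*x~x (+ n) = n*n~n n
x*x~x x@(ℤ.-[1+ n ]) = begin
  x ℤ.* x                     ≈⟨ *-cong-~ (-x~x (+ suc n)) (-x~x (+ suc n)) ⟩
  (+ suc n) ℤ.* (+ suc n)     ≈⟨ n*n~n (suc n) ⟩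
  + suc n                     ≈⟨ -x~x (+ suc n) ⟨
  x                           ∎
  where open SetoidReasoning ~-setoid

-- The ring laws for formal power series

tail : Ser → Ser
tail f n = f (suc n)

_⊞_ : Ser → Ser → Ser
(f ⊞ g) n = f n ℤ.+ g n

zeroSer : Ser
zeroSer _ = 0ℤ

sumTo-cong : ∀ n {f g : ℕ → ℤ} → (∀ j → j ≤ n → f j ≡ g j) → sumTo n f ≡ sumTo n g
sumTo-cong zero e = e 0 z≤n
sumTo-cong (suc n) e =
  cong₂ ℤ._+_ (sumTo-cong n λ j j≤n → e j (ℕₚ.m≤n⇒m≤1+n j≤n)) (e (suc n) ℕₚ.≤-refl)

sumTo-head : ∀ n (f : ℕ → ℤ) → sumTo (suc n) f ≡ f 0 ℤ.+ sumTo n (f ∘ suc)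
sumTo-head zero f = refl
sumTo-head (suc n) f =
  trans (cong (ℤ._+ f (suc (suc n))) (sumTo-head n f)) (ℤₚ.+-assoc (f 0) _ _)

-- Peeling off the first coefficient of f allows induction on the degree with `tail f` in place of
-- f. `mul-last` peels from the other end, and commutativity matches the two.
mul-head : ∀ f g n → mul f g (suc n) ≡ f 0 ℤ.* g (suc n) ℤ.+ mul (tail f) g n
mul-head f g n = sumTo-head n _

mul-last : ∀ f g n → mul f g (suc n) ≡ mul f (tail g) n ℤ.+ f (suc n) ℤ.* g 0
mul-last f g n = cong₂ ℤ._+_
  (sumTo-cong n λ j j≤n → cong (λ k → f j ℤ.* g k) (ℕₚ.+-∸-assoc 1 j≤n))
  (cong (λ k → f (suc n) ℤ.* g k) (ℕₚ.n∸n≡0 n))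

mul-comm : ∀ f g n → mul f g n ≡ mul g f n
mul-comm f g zero = ℤₚ.*-comm (f 0) (g 0)
mul-comm f g (suc n) = begin
  mul f g (suc n)                            ≡⟨ mul-head f g n ⟩
  f 0 ℤ.* g (suc n) ℤ.+ mul (tail f) g n     ≡⟨ cong₂ ℤ._+_ (ℤₚ.*-comm (f 0) _) (mul-comm (tail f) g n) ⟩
  g (suc n) ℤ.* f 0 ℤ.+ mul g (tail f) n     ≡⟨ ℤₚ.+-comm _ (mul g (tail f) n) ⟩
  mul g (tail f) n ℤ.+ g (suc n) ℤ.* f 0     ≡⟨ mul-last g f n ⟨
  mul g f (suc n)                            ∎
  where open ≡-Reasoning

mul-distribʳ : ∀ f g h n → mul (g ⊞ h) f n ≡ mul g f n ℤ.+ mul h f n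
mul-distribʳ f g h zero = ℤₚ.*-distribʳ-+ (f 0) (g 0) (h 0)
mul-distribʳ f g h (suc n) = begin
  mul (g ⊞ h) f (suc n)
    ≡⟨ mul-head (g ⊞ h) f n ⟩
  (g 0 ℤ.+ h 0) ℤ.* f (suc n) ℤ.+ mul (tail g ⊞ tail h) f n
    ≡⟨ cong (λ z → (g 0 ℤ.+ h 0) ℤ.* f (suc n) ℤ.+ z) (mul-distribʳ f (tail g) (tail h) n) ⟩
  (g 0 ℤ.+ h 0) ℤ.* f (suc n) ℤ.+ (mul (tail g) f n ℤ.+ mul (tail h) f n)
    ≡⟨ shuffle (g 0) (h 0) (f (suc n)) _ _ ⟩
  (g 0 ℤ.* f (suc n) ℤ.+ mul (tail g) f n) ℤ.+ (h 0 ℤ.* f (suc n) ℤ.+ mul (tail h) f n)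
    ≡⟨ cong₂ ℤ._+_ (mul-head g f n) (mul-head h f n) ⟨
  mul g f (suc n) ℤ.+ mul h f (suc n) ∎
  where
  open ≡-Reasoning
  shuffle : ∀ a b c d e → (a ℤ.+ b) ℤ.* c ℤ.+ (d ℤ.+ e) ≡ (a ℤ.* c ℤ.+ d) ℤ.+ (b ℤ.* c ℤ.+ e)
  shuffle = solve-∀

mul-congˡ-≗ : ∀ {f g} h n → (∀ i → f i ≡ g i) → mul f h n ≡ mul g h n
mul-congˡ-≗ h n e = sumTo-cong n λ j _ → cong (ℤ._* h (n ∸ j)) (e j)

mul-scale : ∀ c f g n → mul (λ i → c ℤ.* f i) g n ≡ c ℤ.* mul f g n
mul-scale c f g zero = ℤₚ.*-assoc c (f 0) (g 0)
mul-scale c f g (suc n) = begin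
  mul (λ i → c ℤ.* f i) g (suc n)                         ≡⟨ mul-head (λ i → c ℤ.* f i) g n ⟩
  c ℤ.* f 0 ℤ.* g (suc n) ℤ.+ mul (λ i → c ℤ.* tail f i) g n
    ≡⟨ cong₂ ℤ._+_ (ℤₚ.*-assoc c _ _) (mul-scale c (tail f) g n) ⟩
  c ℤ.* (f 0 ℤ.* g (suc n)) ℤ.+ c ℤ.* mul (tail f) g n    ≡⟨ ℤₚ.*-distribˡ-+ c _ _ ⟨
  c ℤ.* (f 0 ℤ.* g (suc n) ℤ.+ mul (tail f) g n)          ≡⟨ cong (c ℤ.*_) (mul-head f g n) ⟨
  c ℤ.* mul f g (suc n)                                   ∎
  where open ≡-Reasoning

mul-assoc : ∀ f g h n → mul (mul f g) h n ≡ mul f (mul g h) n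
mul-assoc f g h zero = ℤₚ.*-assoc (f 0) (g 0) (h 0)
mul-assoc f g h (suc n) = begin
  mul (mul f g) h (suc n)
    ≡⟨ mul-head (mul f g) h n ⟩
  f 0 ℤ.* g 0 ℤ.* h (suc n) ℤ.+ mul (tail (mul f g)) h n
    ≡⟨ cong (λ z → f 0 ℤ.* g 0 ℤ.* h (suc n) ℤ.+ z) (mul-congˡ-≗ h n (mul-head f g)) ⟩
  f 0 ℤ.* g 0 ℤ.* h (suc n) ℤ.+ mul ((λ i → f 0 ℤ.* tail g i) ⊞ mul (tail f) g) h n
    ≡⟨ cong (λ z → f 0 ℤ.* g 0 ℤ.* h (suc n) ℤ.+ z) (mul-distribʳ h (λ i → f 0 ℤ.* tail g i) (mul (tail f) g) n) ⟩
  f 0 ℤ.* g 0 ℤ.* h (suc n) ℤ.+ (mul (λ i → f 0 ℤ.* tail g i) h n ℤ.+ mul (mul (tail f) g) h n)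
    ≡⟨ cong₂ (λ x y → f 0 ℤ.* g 0 ℤ.* h (suc n) ℤ.+ (x ℤ.+ y)) (mul-scale (f 0) (tail g) h n) (mul-assoc (tail f) g h n) ⟩
  f 0 ℤ.* g 0 ℤ.* h (suc n) ℤ.+ (f 0 ℤ.* mul (tail g) h n ℤ.+ mul (tail f) (mul g h) n)
    ≡⟨ shuffle (f 0) (g 0) (h (suc n)) _ _ ⟩
  f 0 ℤ.* (g 0 ℤ.* h (suc n) ℤ.+ mul (tail g) h n) ℤ.+ mul (tail f) (mul g h) n
    ≡⟨ cong (λ x → f 0 ℤ.* x ℤ.+ mul (tail f) (mul g h) n) (mul-head g h n) ⟨
  f 0 ℤ.* mul g h (suc n) ℤ.+ mul (tail f) (mul g h) n
    ≡⟨ mul-head f (mul g h) n ⟨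
  mul f (mul g h) (suc n) ∎
  where
  open ≡-Reasoning
  shuffle : ∀ a b c d e → a ℤ.* b ℤ.* c ℤ.+ (a ℤ.* d ℤ.+ e) ≡ a ℤ.* (b ℤ.* c ℤ.+ d) ℤ.+ e
  shuffle = solve-∀

mul-zeroˡ : ∀ f n → mul zeroSer f n ≡ 0ℤ
mul-zeroˡ f zero = refl
mul-zeroˡ f (suc n) = trans (mul-head zeroSer f n) (cong (λ z → 0ℤ ℤ.+ z) (mul-zeroˡ f n))

mul-oneˡ : ∀ f n → mul one f n ≡ f n
mul-oneˡ f zero = ℤₚ.*-identityˡ (f 0)
mul-oneˡ f (suc n) = begin
  mul one f (suc n)                     ≡⟨ mul-head one f n ⟩
  1ℤ ℤ.* f (suc n) ℤ.+ mul zeroSer f n  ≡⟨ cong₂ ℤ._+_ (ℤₚ.*-identityˡ (f (suc n))) (mul-zeroˡ f n) ⟩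
  f (suc n) ℤ.+ 0ℤ                      ≡⟨ ℤₚ.+-identityʳ _ ⟩
  f (suc n)                             ∎
  where open ≡-Reasoning

-- Series modulo 2, truncated in degree

sumTo-cong-~ : ∀ n {f g : ℕ → ℤ} → (∀ j → j ≤ n → f j ~ g j) → sumTo n f ~ sumTo n g
sumTo-cong-~ zero e = e 0 z≤n
sumTo-cong-~ (suc n) e =
  +-cong-~ (sumTo-cong-~ n λ j j≤n → e j (ℕₚ.m≤n⇒m≤1+n j≤n)) (e (suc n) ℕₚ.≤-refl)

record Agree (M : ℕ) (f g : Ser) : Set where
  constructor agree
  field at : ∀ i → i ≤ M → f i ~ g i

open Agree

-- Power series over 𝔽₂ modulo q^(M+1), with integer representatives.
truncated : ℕ → CommutativeSemiring 0ℓ 0ℓ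
truncated M = record
  { Carrier = Ser
  ; _≈_ = Agree M
  ; _+_ = _⊞_
  ; _*_ = mul
  ; 0# = zeroSer
  ; 1# = one
  ; isCommutativeSemiring = IsCommutativeSemiringˡ.isCommutativeSemiring record
    { +-isCommutativeMonoid = record
      { isMonoid = record
        { isSemigroup = record
          { isMagma = record
            { isEquivalence = isEquivalence
            ; ∙-cong = λ (agree e) (agree e′) → agree λ i i≤M → +-cong-~ (e i i≤M) (e′ i i≤M)
            }
          ; assoc = λ f g h → ≗⇒≈ λ i → ℤₚ.+-assoc (f i) (g i) (h i)
          }
        ; identity = (λ f → ≗⇒≈ λ i → ℤₚ.+-identityˡ (f i)) , (λ f → ≗⇒≈ λ i → ℤₚ.+-identityʳ (f i))
        }
      ; comm = λ f g → ≗⇒≈ λ i → ℤₚ.+-comm (f i) (g i)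
      }
    ; *-isCommutativeMonoid = record
      { isMonoid = record
        { isSemigroup = record
          { isMagma = record
            { isEquivalence = isEquivalence
            ; ∙-cong = λ (agree e) (agree e′) → agree λ i i≤M → sumTo-cong-~ i λ j j≤i →
                *-cong-~ (e j (ℕₚ.≤-trans j≤i i≤M)) (e′ (i ∸ j) (ℕₚ.≤-trans (ℕₚ.m∸n≤m i j) i≤M))
            }
          ; assoc = λ f g h → ≗⇒≈ (mul-assoc f g h)
          }
        ; identity = (λ f → ≗⇒≈ (mul-oneˡ f)) , (λ f → ≗⇒≈ λ i → trans (mul-comm f one i) (mul-oneˡ f i))
        }
      ; comm = λ f g → ≗⇒≈ (mul-comm f g)
      }
    ; distribʳ = λ f g h → ≗⇒≈ (mul-distribʳ f g h)
    ; zeroˡ = λ f → ≗⇒≈ (mul-zeroˡ f)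
    }
  }
  where
  ≗⇒≈ : ∀ {f g : Ser} → (∀ i → f i ≡ g i) → Agree M f g
  ≗⇒≈ e = agree λ i _ → ~-reflexive (e i)
  isEquivalence : IsEquivalence (Agree M)
  isEquivalence = record
    { refl = agree λ _ _ → ~-refl
    ; sym = λ (agree e) → agree λ i i≤M → ~-sym (e i i≤M)
    ; trans = λ (agree e) (agree e′) → agree λ i i≤M → ~-trans (e i i≤M) (e′ i i≤M)
    }

-- Squares and 2-dissections modulo 2

-- The two outermost terms of the convolution are equal and cancel.
square-step : ∀ f n → mul f f (suc (suc n)) ~ mul (tail f) (tail f) n
square-step f n = ~-trans
  (~-reflexive (begin
    mul f f (2 + n)                                             ≡⟨ mul-head f f (suc n) ⟩
    f 0 ℤ.* f (2 + n) ℤ.+ mul (tail f) f (suc n)                ≡⟨ cong (λ z → f 0 ℤ.* f (2 + n) ℤ.+ z) (mul-last (tail f) f n) ⟩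
    f 0 ℤ.* f (2 + n) ℤ.+ (mul (tail f) (tail f) n ℤ.+ f (2 + n) ℤ.* f 0)
      ≡⟨ shuffle (f 0) (f (2 + n)) (mul (tail f) (tail f) n) ⟩
    mul (tail f) (tail f) n ℤ.+ (f 0 ℤ.* f (2 + n) ℤ.+ f 0 ℤ.* f (2 + n)) ∎))
  (~-trans (+-cong-~ (~-refl {mul (tail f) (tail f) n}) (x+x~0 (f 0 ℤ.* f (2 + n))))
           (~-reflexive (ℤₚ.+-identityʳ _)))
  where
  open ≡-Reasoning
  shuffle : ∀ a b c → a ℤ.* b ℤ.+ (c ℤ.+ b ℤ.* a) ≡ c ℤ.+ (a ℤ.* b ℤ.+ a ℤ.* b)
  shuffle = solve-∀

-- After n cancellations only the middle term f_n² is left, and it is f_n modulo 2. In odd degree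
-- there is no middle term.
square-even : ∀ f n → mul f f (n + n) ~ f n
square-even f zero = x*x~x (f 0)
square-even f (suc n) rewrite ℕₚ.+-suc n n = ~-trans (square-step f (n + n)) (square-even (tail f) n)

square-odd : ∀ f n → mul f f (suc (n + n)) ~ 0ℤ
square-odd f zero = ~-trans (+-cong-~ (~-refl {f 0 ℤ.* f 1}) (~-reflexive (ℤₚ.*-comm (f 1) (f 0)))) (x+x~0 (f 0 ℤ.* f 1))
square-odd f (suc n) rewrite ℕₚ.+-suc n n = ~-trans (square-step f (suc (n + n))) (square-odd (tail f) n)

q : Ser
q n = if n ≡ᵇ 1 then + 1 else + 0

mul-q-suc : ∀ f n → mul q f (suc n) ≡ f n
mul-q-suc f n = trans (mul-head q f n)
  (trans (ℤₚ.+-identityˡ _) (trans (mul-congˡ-≗ f n tail-q) (mul-oneˡ f n)))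
  where
  tail-q : ∀ i → tail q i ≡ one i
  tail-q zero = refl
  tail-q (suc i) = refl

-- f² lives in even degrees and q g² in odd ones, so f and g are each recovered at half the index.
section-even : ∀ f g n → (mul f f ⊞ mul q (mul g g)) (n + n) ~ f n
section-even f g n = ~-trans (+-cong-~ (square-even f n) (shifted n)) (~-reflexive (ℤₚ.+-identityʳ (f n)))
  where
  shifted : ∀ n → mul q (mul g g) (n + n) ~ 0ℤ
  shifted zero = ~-refl
  shifted (suc n) = ~-trans (~-reflexive (mul-q-suc (mul g g) (n + suc n)))
    (subst (λ k → mul g g k ~ 0ℤ) (sym (ℕₚ.+-suc n n)) (square-odd g n))

section-odd : ∀ f g n → (mul f f ⊞ mul q (mul g g)) (suc (n + n)) ~ g n
section-odd f g n = ~-trans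
  (+-cong-~ (square-odd f n) (~-trans (~-reflexive (mul-q-suc (mul g g) (n + n))) (square-even g n)))
  (~-reflexive (ℤₚ.+-identityˡ (g n)))

-- Powers of q and geometric series

qPow-below : ∀ k n → n < k → pow q k n ≡ 0ℤ
qPow-below (suc k) zero _ = refl
qPow-below (suc k) (suc n) (s≤s n<k) = trans (mul-q-suc (pow q k) n) (qPow-below k n n<k)

mul-qPow-below : ∀ k f n → n < k → mul (pow q k) f n ≡ 0ℤ
mul-qPow-below (suc k) f zero _ = refl
mul-qPow-below (suc k) f (suc n) (s≤s n<k) = begin
  mul (mul q (pow q k)) f (suc n) ≡⟨ mul-assoc q (pow q k) f (suc n) ⟩
  mul q (mul (pow q k) f) (suc n) ≡⟨ mul-q-suc (mul (pow q k) f) n ⟩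
  mul (pow q k) f n               ≡⟨ mul-qPow-below k f n n<k ⟩
  0ℤ                              ∎
  where open ≡-Reasoning

mul-qPow-shift : ∀ k f n → mul (pow q k) f (k + n) ≡ f n
mul-qPow-shift zero f n = mul-oneˡ f n
mul-qPow-shift (suc k) f n = begin
  mul (mul q (pow q k)) f (suc (k + n)) ≡⟨ mul-assoc q (pow q k) f (suc (k + n)) ⟩
  mul q (mul (pow q k) f) (suc (k + n)) ≡⟨ mul-q-suc (mul (pow q k) f) (k + n) ⟩
  mul (pow q k) f (k + n)               ≡⟨ mul-qPow-shift k f n ⟩
  f n                                   ∎
  where open ≡-Reasoning

qPow-coeff : ∀ k n → pow q k n ≡ (if n ≡ᵇ k then + 1 else + 0)
qPow-coeff zero n = refl
qPow-coeff (suc k) zero = refl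
qPow-coeff (suc k) (suc n) = trans (mul-q-suc (pow q k) n) (qPow-coeff k n)

oneMinus-~ : ∀ k n → oneMinus (suc k) n ~ (one ⊞ pow q (suc k)) n
oneMinus-~ k zero = ~-refl
oneMinus-~ k (suc n) rewrite mul-q-suc (pow q k) n | qPow-coeff k n with n ≡ᵇ k
... | true = -x~x 1ℤ
... | false = ~-refl

-- The geometric series has coefficients of period k+1, so multiplication by 1 + q^(k+1) adds each
-- one to its equal. Degrees below k+1 have no partner, and there only the constant term is nonzero.
geom-inverse : ∀ k n → mul (one ⊞ pow q (suc k)) (geom (suc k)) n ~ one n
geom-inverse k n = ~-trans (~-reflexive (trans (mul-distribʳ g one Q n) (cong (ℤ._+ mul Q g n) (mul-oneˡ g n)))) main
  where
  g = geom (suc k)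
  Q = pow q (suc k)
  main : g n ℤ.+ mul Q g n ~ one n
  main with n ℕₚ.<? suc k
  ... | yes n<k rewrite mul-qPow-below (suc k) g n n<k | m<n⇒m%n≡m n<k = ~-reflexive (ℤₚ.+-identityʳ (one n))
  ... | no n≮k = subst (λ n → g n ℤ.+ mul Q g n ~ one n) (ℕₚ.m+[n∸m]≡n (ℕₚ.≮⇒≥ n≮k)) (periodic (n ∸ suc k))
    where
    periodic : ∀ r → g (suc k + r) ℤ.+ mul Q g (suc k + r) ~ one (suc k + r)
    periodic r = ~-trans (~-reflexive (cong₂ ℤ._+_ g-periodic (mul-qPow-shift (suc k) g r))) (x+x~0 (g r))
      where
      g-periodic : g (suc k + r) ≡ g r
      g-periodic = cong (λ m → if m ≡ᵇ 0 then + 1 else + 0)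
        (trans (cong (_% suc k) (ℕₚ.+-comm (suc k) r)) ([m+n]%n≡m%n r (suc k)))

-- The indicator of triangular numbers

triangular? : ∀ l → Dec (∃ λ j → T j ≡ l)
triangular? l = map′ (λ (j , _ , eq) → j , eq)
  (λ (j , eq) → j , s≤s (subst (j ≤_) eq (n≤T j)) , eq)
  (ℕₚ.anyUpTo? (λ j → T j ℕₚ.≟ l) (suc l))

χ : ℕ → ℤ
χ l = if does (triangular? l) then 1ℤ else 0ℤ

T-mono-≤ : ∀ {i j} → i ≤ j → T i ≤ T j
T-mono-≤ z≤n = z≤n
T-mono-≤ (s≤s i≤j) = ℕₚ.+-mono-≤ (T-mono-≤ i≤j) (s≤s i≤j)

T-mono-< : ∀ {i j} → i < j → T i < T j
T-mono-< {i} i<j = ℕₚ.<-≤-trans (ℕₚ.m<m+n (T i) z<s) (T-mono-≤ i<j)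

T-injective : ∀ {i j} → T i ≡ T j → i ≡ j
T-injective {i} {j} eq with ℕₚ.<-cmp i j
... | tri< i<j _ _ = contradiction eq (ℕₚ.<⇒≢ (T-mono-< i<j))
... | tri≈ _ i≡j _ = i≡j
... | tri> _ _ j<i = contradiction (sym eq) (ℕₚ.<⇒≢ (T-mono-< j<i))

1+1≈0 : ∀ M → Agree M (one ⊞ one) zeroSer
1+1≈0 M = agree λ i _ → x+x~0 (one i)

-- Coefficients of P in degrees 8l+2 and 24l+4

module Coefficients (M : ℕ) (M>0 : 0 < M) where

  open Char2 (truncated M) (1+1≈0 M) hiding (refl; sym; trans)
  module R = CommutativeSemiring (truncated M)

  ↑≡pow : ∀ f k → f ↑ k ≡ pow f k
  ↑≡pow f zero = refl
  ↑≡pow f (suc k) = cong (mul f) (↑≡pow f k)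

  prodTo≡∏ : ∀ F n → prodTo F n ≡ ∏ F n
  prodTo≡∏ F zero = refl
  prodTo≡∏ F (suc n) = cong (λ f → mul f (F (suc n))) (prodTo≡∏ F n)

  q^≈0 : ∀ k → M < k → q ↑ k ≈ 𝟘
  q^≈0 k M<k = agree λ i i≤M → ~-reflexive (trans (cong (λ f → f i) (↑≡pow q k)) (qPow-below k i (ℕₚ.≤-<-trans i≤M M<k)))

  geom-unit : ∀ k → (𝟙 ⊕ q ↑ suc k) ⊗ geom (suc k) ≈ 𝟙
  geom-unit k = subst (λ f → (𝟙 ⊕ f) ⊗ geom (suc k) ≈ 𝟙) (sym (↑≡pow q (suc k))) (agree λ i _ → geom-inverse k i)

  oneMinus≈ : ∀ k → oneMinus (suc k) ≈ 𝟙 ⊕ q ↑ suc k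
  oneMinus≈ k = subst (λ f → oneMinus (suc k) ≈ 𝟙 ⊕ f) (sym (↑≡pow q (suc k))) (agree λ i _ → oneMinus-~ k i)

  open EtaQuotient q M M>0 q^≈0 oneMinus geom oneMinus≈ geom-unit

  -- The root of the square P is 1/(ψ(q) ψ(q³)), stated here as f² + q g² in readiness for the next
  -- halving.
  coefP≈ : ∀ s → s + s ≤ M → prodTo factorP M (s + s) ~ ((t ⊗ e₃) ⊗ (t ⊗ e₃) ⊕ q ⊗ ((t₃ ⊗ e) ⊗ (t₃ ⊗ e))) s
  coefP≈ s s+s≤M = ~-trans (at (R.trans (R.reflexive (prodTo≡∏ factorP M)) ∏-factor≈square) (s + s) s+s≤M)
    (square-even ((t ⊗ e₃) ⊗ (t ⊗ e₃) ⊕ q ⊗ ((t₃ ⊗ e) ⊗ (t₃ ⊗ e))) s)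

  q^-same : ∀ n → (q ↑ n) n ≡ 1ℤ
  q^-same zero = refl
  q^-same (suc n) = trans (mul-q-suc (q ↑ n) n) (q^-same n)

  q^-other : ∀ k n → k ≢ n → (q ↑ k) n ≡ 0ℤ
  q^-other zero zero k≢n = contradiction refl k≢n
  q^-other zero (suc n) k≢n = refl
  q^-other (suc k) zero k≢n = refl
  q^-other (suc k) (suc n) k≢n = trans (mul-q-suc (q ↑ k) n) (q^-other k n (k≢n ∘ cong suc))

  ∑-miss : ∀ n (φ : ℕ → ℕ) l → (∀ j → φ j ≢ l) → ∑ n (λ j → q ↑ φ j) l ≡ 0ℤ
  ∑-miss zero φ l miss = refl
  ∑-miss (suc n) φ l miss = cong₂ ℤ._+_ (q^-other (φ 0) l (miss 0)) (∑-miss n (φ ∘ suc) l (miss ∘ suc))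

  ∑-hit : ∀ n (φ : ℕ → ℕ) j → (∀ {i} → φ i ≡ φ j → i ≡ j) → j < n → ∑ n (λ i → q ↑ φ i) (φ j) ≡ 1ℤ
  ∑-hit (suc n) φ zero inj _ =
    cong₂ ℤ._+_ (q^-same (φ 0)) (∑-miss n (φ ∘ suc) (φ 0) λ i eq → contradiction (inj eq) λ ())
  ∑-hit (suc n) φ (suc j) inj (s≤s j<n) =
    cong₂ ℤ._+_ (q^-other (φ 0) (φ (suc j)) λ eq → contradiction (inj eq) λ ())
      (∑-hit n (φ ∘ suc) j (ℕₚ.suc-injective ∘ inj) j<n)

  θ-coefficient : ∀ c .{{_ : NonZero c}} l → c * l ≤ M → θ (q ↑ c) K (c * l) ~ χ l
  θ-coefficient c l c*l≤M = ~-trans (at (∑-cong K (λ j → ^-assocʳ q c (T j))) (c * l) c*l≤M) (~-reflexive (χ-value c*l≤M (triangular? l)))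
    where
    χ-value : ∀ {l} → c * l ≤ M → (d : Dec (∃ λ j → T j ≡ l)) →
              ∑ K (λ j → q ↑ (c * T j)) (c * l) ≡ (if does d then 1ℤ else 0ℤ)
    χ-value c*l≤M (yes (j , refl)) = ∑-hit K (λ j → c * T j) j (λ {i} eq → T-injective (ℕₚ.*-cancelˡ-≡ (T i) (T j) c eq))
      -- j ≤ T j ≤ c · T j ≤ M < K, so the term lies inside the truncated theta sum.
      (ℕₚ.≤-<-trans (ℕₚ.≤-trans (n≤T j) (ℕₚ.≤-trans (ℕₚ.m≤n*m (T j) c) c*l≤M)) N<K)
    χ-value {l} _ (no miss) = ∑-miss K (λ j → c * T j) (c * l) λ j eq → miss (j , ℕₚ.*-cancelˡ-≡ (T j) l c eq)

  θ₁-coefficient : ∀ l → l ≤ M → t l ~ χ l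
  θ₁-coefficient l l≤M = ~-trans (at (∑-cong K (λ j → ^-congˡ (T j) (R.sym (*-identityʳ q)))) l l≤M)
    (subst (λ k → θ (q ↑ 1) K k ~ χ l) (ℕₚ.*-identityˡ l)
      (θ-coefficient 1 l (subst (_≤ M) (sym (ℕₚ.*-identityˡ l)) l≤M)))

  -- The index descends 8l+2, 4l+1, 2l, l. Odd 4l+1 selects ψ(q³)/ψ(q), and even 2l then selects
  -- ψ(q).
  coefP-8l+2 : ∀ l → let r = l + l ; s = suc (r + r) in s + s ≤ M → prodTo factorP M (s + s) ~ χ l
  coefP-8l+2 l s+s≤M =
    ~-trans (coefP≈ s s+s≤M)
    (~-trans (section-odd (t ⊗ e₃) (t₃ ⊗ e) r)
    (~-trans (at quotient₃ r r≤M)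
    (~-trans (section-even t (t₃ ⊗ t₃ ⊗ e) l)
    (θ₁-coefficient l (ℕₚ.≤-trans (ℕₚ.m≤m+n l l) r≤M)))))
    where
    r = l + l
    s = suc (r + r)
    r≤M = ℕₚ.≤-trans (ℕₚ.≤-trans (ℕₚ.m≤n⇒m≤1+n (ℕₚ.m≤m+n r r)) (ℕₚ.m≤m+n s s)) s+s≤M

  -- The index descends 24l+4, 12l+2, 6l+1, 3l. Even 12l+2 selects ψ(q)/ψ(q³), and odd 6l+1 then
  -- selects ψ(q³).
  coefP-24l+4 : ∀ l → let m = 3 * l ; r = suc (m + m) ; s = r + r in s + s ≤ M → prodTo factorP M (s + s) ~ χ l
  coefP-24l+4 l s+s≤M =
    ~-trans (coefP≈ s s+s≤M)
    (~-trans (section-even (t ⊗ e₃) (t₃ ⊗ e) r)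
    (~-trans (at quotient r r≤M)
    (~-trans (section-odd (t ⊗ t ⊗ e₃) t₃ m)
    (θ-coefficient 3 l (ℕₚ.≤-trans (ℕₚ.m≤n⇒m≤1+n (ℕₚ.m≤m+n m m)) r≤M)))))
    where
    m = 3 * l
    r = suc (m + m)
    s = r + r
    r≤M = ℕₚ.≤-trans (ℕₚ.≤-trans (ℕₚ.m≤m+n r r) (ℕₚ.m≤m+n s s)) s+s≤M

-- Coefficients of the Hauptmodul modulo 2

J6*~coefP : ∀ {N M} → 0 < N → suc N ≡ M → J6* N ~ coefP M
J6*~coefP {suc n} _ refl = ~-trans
  (+-cong-~ (~-refl {coefP (suc (suc n))}) (*-cong-~ (mod2 {+ 64} {0ℤ} (Signed.divides (+ 32) refl)) (~-refl {coefQ n})))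
  (~-reflexive (ℤₚ.+-identityʳ (coefP (suc (suc n)))))

J6*-8l+1 : ∀ l → J6* (8 * l + 1) ~ χ l
-- `coefP` takes as many factors as its index, so the truncation order is the index s + s itself.
J6*-8l+1 l = ~-trans (J6*~coefP (ℕₚ.m≤n+m 1 (8 * l)) index) (Coefficients.coefP-8l+2 (s + s) z<s l ℕₚ.≤-refl)
  where
  open +-*-Solver
  s = suc (l + l + (l + l))
  index : suc (8 * l + 1) ≡ s + s
  index = solve 1 (λ l → let s = con 1 :+ (l :+ l :+ (l :+ l)) in con 1 :+ (con 8 :* l :+ con 1) := s :+ s) refl l

J6*-3[8l+1] : ∀ l → J6* (3 * (8 * l + 1)) ~ χ l
J6*-3[8l+1] l = ~-trans (J6*~coefP (ℕₚ.*-monoʳ-< 3 (ℕₚ.m≤n+m 1 (8 * l))) index)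
  (Coefficients.coefP-24l+4 (s + s) z<s l ℕₚ.≤-refl)
  where
  open +-*-Solver
  s = suc (3 * l + 3 * l) + suc (3 * l + 3 * l)
  index : suc (3 * (8 * l + 1)) ≡ s + s
  index = solve 1 (λ l → let r = con 1 :+ (con 3 :* l :+ con 3 :* l) in
    con 1 :+ con 3 :* (con 8 :* l :+ con 1) := (r :+ r) :+ (r :+ r)) refl l

-- Squares and multiplication by p²

triangular⇔square : ∀ l → (∃ λ j → T j ≡ l) ⇔ (∃ λ x → x * x ≡ 8 * l + 1)
triangular⇔square l = mk⇔ (λ { (j , refl) → suc (j + j) , square j }) root
  where
  open +-*-Solver
  square : ∀ j → suc (j + j) * suc (j + j) ≡ 8 * T j + 1
  square j = begin
    suc (j + j) * suc (j + j)
      ≡⟨ solve 1 (λ j → (con 1 :+ (j :+ j)) :* (con 1 :+ (j :+ j)) := con 4 :* (j :* (con 1 :+ j)) :+ con 1) refl j ⟩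
    4 * (j * suc j) + 1
      ≡⟨ cong (λ y → 4 * y + 1) (2*T j) ⟨
    4 * (2 * T j) + 1
      ≡⟨ cong (_+ 1) (ℕₚ.*-assoc 4 2 (T j)) ⟨
    8 * T j + 1 ∎
    where open ≡-Reasoning
  halve : ∀ x → (∃ λ j → x ≡ j + j) ⊎ (∃ λ j → x ≡ suc (j + j))
  halve zero = inj₁ (0 , refl)
  halve (suc x) with halve x
  ... | inj₁ (j , refl) = inj₂ (j , refl)
  ... | inj₂ (j , refl) = inj₁ (suc j , cong suc (sym (ℕₚ.+-suc j j)))
  root : (∃ λ x → x * x ≡ 8 * l + 1) → ∃ λ j → T j ≡ l
  root (x , eq) with halve x
  -- An even root would make 8l+1 even.
  ... | inj₁ (j , refl) = contradiction
    (trans (solve 1 (λ l → con 2 :* (con 4 :* l) :+ con 1 := con 8 :* l :+ con 1) refl l)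
      (trans (sym eq) (solve 1 (λ j → (j :+ j) :* (j :+ j) := con 2 :* (con 2 :* j :* j)) refl j)))
    (λ eq′ → ℕₚ.even≢odd (2 * j * j) (4 * l) (trans (sym eq′) (ℕₚ.+-comm (2 * (4 * l)) 1)))
  ... | inj₂ (j , refl) = j , ℕₚ.*-cancelˡ-≡ (T j) l 8 (ℕₚ.+-cancelʳ-≡ 1 (8 * T j) (8 * l) (trans (sym (square j)) eq))

-- From p ∣ y² primality gives p ∣ y, and then p² cancels.
square-scale⇔ : ∀ {p} .{{_ : NonZero p}} → Prime p → ∀ a → (∃ λ x → x * x ≡ p * p * a) ⇔ (∃ λ x → x * x ≡ a)
square-scale⇔ {p} p-prime a = mk⇔ descend (λ { (x , refl) → p * x , scale x })
  where
  open +-*-Solver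
  scale : ∀ x → p * x * (p * x) ≡ p * p * (x * x)
  scale = solve 2 (λ p x → p :* x :* (p :* x) := p :* p :* (x :* x)) refl p
  divide : ∀ y → y * y ≡ p * p * a → p ∣ y → ∃ λ x → x * x ≡ a
  divide _ eq (divides x refl) = x , ℕₚ.*-cancelˡ-≡ (x * x) a (p * p) {{ℕₚ.m*n≢0 p p}}
    (trans (sym (scale x)) (trans (cong (λ y → y * y) (ℕₚ.*-comm p x)) eq))
  descend : (∃ λ y → y * y ≡ p * p * a) → ∃ λ x → x * x ≡ a
  descend (y , eq) with euclidsLemma y y p-prime (divides (p * a) (trans eq (trans (ℕₚ.*-assoc p p a) (ℕₚ.*-comm p (p * a)))))
  ... | inj₁ p∣y = divide y eq p∣y
  ... | inj₂ p∣y = divide y eq p∣y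

χ-scale : ∀ {p} .{{_ : NonZero p}} → Prime p → ∀ l l′ → 8 * l′ + 1 ≡ p * p * (8 * l + 1) → χ l′ ≡ χ l
χ-scale {p} p-prime l l′ eq = cong (λ b → if b then 1ℤ else 0ℤ) (does-⇔
  (mk⇔ (from (triangular⇔square l) ∘ to (square-scale⇔ p-prime (8 * l + 1)) ∘ subst Squared eq ∘ to (triangular⇔square l′))
       (from (triangular⇔square l′) ∘ subst Squared (sym eq) ∘ from (square-scale⇔ p-prime (8 * l + 1)) ∘ to (triangular⇔square l)))
  (triangular? l′) (triangular? l))
  where
  open Equivalence
  Squared : ℕ → Set
  Squared a = ∃ λ x → x * x ≡ a

J6*-χ : ∀ {m} → m ≡ 0 ⊎ m ≡ 1 → ∀ l → J6* (3 ^ m * (8 * l + 1)) ~ χ l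
J6*-χ (inj₁ refl) l = subst (λ n → J6* n ~ χ l) (sym (ℕₚ.*-identityˡ (8 * l + 1))) (J6*-8l+1 l)
J6*-χ (inj₂ refl) l = J6*-3[8l+1] l

-- Residues modulo 8 and the passage from N₁ to N₂

8l+1-form : ∀ n → n % 8 ≡ 1 → n ≡ 8 * (n / 8) + 1
8l+1-form n n%8≡1 = trans (m≡m%n+[m/n]*n n 8)
  (trans (cong₂ _+_ n%8≡1 (ℕₚ.*-comm (n / 8) 8)) (ℕₚ.+-comm 1 (8 * (n / 8))))

-- It serves twice: for p² ≡ i² and for p(8δ+i) ≡ i².
%8-square : ∀ {i} → i ≡ 3 ⊎ i ≡ 5 ⊎ i ≡ 7 → (i * i) % 8 ≡ 1
%8-square (inj₁ refl) = refl
%8-square (inj₂ (inj₁ refl)) = refl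
%8-square (inj₂ (inj₂ refl)) = refl

%8-square-scale : ∀ p → (p * p) % 8 ≡ 1 → ∀ a → (p * p * a) % 8 ≡ a % 8
%8-square-scale p p²≡1 a = begin
  (p * p * a) % 8                ≡⟨ %-distribˡ-* (p * p) a 8 ⟩
  ((p * p) % 8 * (a % 8)) % 8    ≡⟨ cong (λ r → (r * (a % 8)) % 8) p²≡1 ⟩
  (1 * (a % 8)) % 8              ≡⟨ cong (_% 8) (ℕₚ.*-identityˡ (a % 8)) ⟩
  a % 8 % 8                      ≡⟨ m%n%n≡m%n a 8 ⟩
  a % 8                          ∎
  where open ≡-Reasoning

theorem1p3 : (k : ℕ) → 1 ≤ k → (i : ℕ) → (i ≡ 3 ⊎ i ≡ 5 ⊎ i ≡ 7) →
    (p : ℕ) → Prime p → .{{_ : NonZero p}} → p % 8 ≡ i →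
    (δ : ℕ) → p ∣ (8 * δ + i) → (m : ℕ) → (m ≡ 0 ⊎ m ≡ 1) → (n : ℕ) →
    (+ 2) ∣ℤ (J6* (3 ^ m * p * (8 * p ^ k * n + 8 * δ + i))
    - J6* (3 ^ m * (8 * p ^ (k ∸ 1) * n + (8 * δ + i) / p)))
theorem1p3 (suc k) _ i i∈ p p-prime p%8≡i δ p∣8δ+i m m∈ n =
  Signed.∣⇒∣ᵤ (_~_.even-difference (~-trans (~-reflexive (cong J6* N₁≡)) J6*-descent))
  where
  open ≡-Reasoning
  d = (8 * δ + i) / p
  a = 8 * p ^ k * n + d
  p²≡1 : (p * p) % 8 ≡ 1
  p²≡1 = begin
    (p * p) % 8              ≡⟨ %-distribˡ-* p p 8 ⟩
    (p % 8 * (p % 8)) % 8    ≡⟨ cong (λ r → (r * r) % 8) p%8≡i ⟩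
    (i * i) % 8              ≡⟨ %8-square i∈ ⟩
    1                        ∎
  p*d≡ : p * d ≡ 8 * δ + i
  p*d≡ = trans (ℕₚ.*-comm p d) (m/n*n≡m p∣8δ+i)
  i%8≡i : i % 8 ≡ i
  i%8≡i = trans (cong (_% 8) (sym p%8≡i)) (trans (m%n%n≡m%n p 8) p%8≡i)
  -- Modulo 8, d ≡ p² d = p(8δ+i) ≡ i² ≡ 1.
  d%8≡1 : d % 8 ≡ 1
  d%8≡1 = begin
    d % 8                             ≡⟨ %8-square-scale p p²≡1 d ⟨
    (p * p * d) % 8                   ≡⟨ cong (_% 8) (trans (ℕₚ.*-assoc p p d) (cong (p *_) p*d≡)) ⟩
    (p * (8 * δ + i)) % 8             ≡⟨ %-distribˡ-* p (8 * δ + i) 8 ⟩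
    (p % 8 * ((8 * δ + i) % 8)) % 8   ≡⟨ cong₂ (λ x y → (x * y) % 8) p%8≡i
        (trans (cong (_% 8) (trans (ℕₚ.+-comm (8 * δ) i) (cong (λ j → i + j) (ℕₚ.*-comm 8 δ)))) (trans ([m+kn]%n≡m%n i δ 8) i%8≡i)) ⟩
    (i * i) % 8                       ≡⟨ %8-square i∈ ⟩
    1                                 ∎
  a%8≡1 : a % 8 ≡ 1
  a%8≡1 = begin
    (8 * p ^ k * n + d) % 8           ≡⟨ cong (_% 8) (solve 3 (λ x n d → con 8 :* x :* n :+ d := d :+ x :* n :* con 8) refl (p ^ k) n d) ⟩
    (d + p ^ k * n * 8) % 8           ≡⟨ [m+kn]%n≡m%n d (p ^ k * n) 8 ⟩
    d % 8                             ≡⟨ d%8≡1 ⟩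
    1                                 ∎
    where open +-*-Solver
  -- One p is the prefactor; the other comes out of p^(k+1) and of 8δ+i = p d.
  N₁≡ : 3 ^ m * p * (8 * p ^ suc k * n + 8 * δ + i) ≡ 3 ^ m * (p * p * a)
  N₁≡ = begin
    3 ^ m * p * (8 * p ^ suc k * n + 8 * δ + i)       ≡⟨ cong (3 ^ m * p *_) (ℕₚ.+-assoc (8 * p ^ suc k * n) (8 * δ) i) ⟩
    3 ^ m * p * (8 * p ^ suc k * n + (8 * δ + i))     ≡⟨ cong (λ y → 3 ^ m * p * (8 * p ^ suc k * n + y)) p*d≡ ⟨
    3 ^ m * p * (8 * p ^ suc k * n + p * d)
      ≡⟨ solve 5 (λ t p x n d → t :* p :* (con 8 :* (p :* x) :* n :+ p :* d) := t :* (p :* p :* (con 8 :* x :* n :+ d)))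
           refl (3 ^ m) p (p ^ k) n d ⟩
    3 ^ m * (p * p * a) ∎
    where open +-*-Solver
  J6*-descent : J6* (3 ^ m * (p * p * a)) ~ J6* (3 ^ m * a)
  J6*-descent = subst₂ (λ x y → J6* (3 ^ m * x) ~ J6* (3 ^ m * y)) (sym b≡) (sym a≡)
    (~-trans (J6*-χ m∈ l′) (~-trans (~-reflexive (χ-scale p-prime l l′ scaled)) (~-sym (J6*-χ m∈ l))))
    where
    l = a / 8
    l′ = (p * p * a) / 8
    a≡ : a ≡ 8 * l + 1
    a≡ = 8l+1-form a a%8≡1
    b≡ : p * p * a ≡ 8 * l′ + 1
    b≡ = 8l+1-form (p * p * a) (trans (%8-square-scale p p²≡1 a) a%8≡1)
    scaled : 8 * l′ + 1 ≡ p * p * (8 * l + 1)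
    scaled = trans (sym b≡) (cong (p * p *_) a≡)
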